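{- Let $k$ be a positive integer, let $G$ be a graph and let $F$ be a spanning forest of $G$. Then $G$ has a spanning tree $T$ containing $F$ such that for each vertex $v$, $$d_T(v)\le\begin{cases}\big\lceil\frac{d_G(v)-d_F(v)-2}{k}\big\rceil+d_F(v)+2, & \text{if } G/F \text{ is } k\text{ -edge-connected};\\ \big\lceil\frac{d_G(v)-d_F(v)-1}{k}\big\rceil+d_F(v)+1, & \text{if } G/F \text{ is } k\text{ -tree-connected}.\end{cases}$$ Furthermore, for any given vertex $u$, the tree $T$ can be chosen so that in addition the bound at $u$ is reduced to $d_T(u)\le\lfloor(d_G(u)-d_F(u))/k\rfloor+d_F(u)$.
   Context: All graphs are finite, without loops, multiple edges allowed; degrees count multiple edges. $G/F$ is the graph obtained from $G$ by contracting each component of $F$ to a single vertex (edges inside a component disappear). A graph is $k$-tree-connected if it has $k$ edge-disjoint spanning trees. -}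

module Defs where

open import Data.Nat as ℕ using (ℕ; zero; suc; NonZero)
open import Data.Fin using (Fin)
open import Data.Fin.Subset using (Subset; _∈_; _∉_; _⊆_; ∣_∣; ∁)
open import Data.Fin.Properties using (_≟_)
open import Data.List using (List; length; map; filter; allFin)
open import Data.Nat.ListAction using (sum)
open import Data.List.Relation.Unary.All using (All)
open import Data.Vec using (lookup)
open import Data.Bool using (Bool; true; false; if_then_else_; _∧_; _∨_)
open import Data.Product using (Σ; _×_; _,_; proj₁; proj₂; ∃)
open import Data.Sum using (_⊎_)
open import Data.Integer as ℤ using (ℤ; -_; _/ℕ_)
open import Relation.Nullary using (¬_; ¬?; does)
open import Relation.Binary.PropositionalEquality using (_≡_; _≢_)
open import Function using (_⇔_; Surjective)

-- Finite loopless multigraphs on vertex set Fin n.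
-- Edges form a list (so parallel edges are allowed); edge i is the
-- i-th entry of the list.  Subgraphs are subsets of edge indices.

record Graph (n : ℕ) : Set where
  field
    edges    : List (Fin n × Fin n)
    loopless : All (λ e → proj₁ e ≢ proj₂ e) edges

  m : ℕ
  m = length edges

  edge : Fin m → Fin n × Fin n
  edge i = Data.List.lookup edges i

open Graph public

EdgeSet : ∀ {n} → Graph n → Set
EdgeSet G = Subset (m G)

incidentᵇ : ∀ {n} (G : Graph n) → Fin (m G) → Fin n → Bool
incidentᵇ G i v = does (proj₁ (edge G i) ≟ v) ∨ does (proj₂ (edge G i) ≟ v)

deg : ∀ {n} (G : Graph n) → EdgeSet G → Fin n → ℕ
deg G S v =
  sum (map (λ i → if lookup S i ∧ incidentᵇ G i v then 1 else 0) (allFin (m G)))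

allEdges : ∀ {n} (G : Graph n) → EdgeSet G
allEdges G = Data.Fin.Subset.⊤

degG : ∀ {n} (G : Graph n) → Fin n → ℕ
degG G = deg G (allEdges G)

data Reach {n} (G : Graph n) (S : EdgeSet G) : Fin n → Fin n → Set where
  here  : ∀ {u} → Reach G S u u
  fwd   : ∀ {u w} (i : Fin (m G)) → i ∈ S → proj₁ (edge G i) ≡ u →
          Reach G S (proj₂ (edge G i)) w → Reach G S u w
  bwd   : ∀ {u w} (i : Fin (m G)) → i ∈ S → proj₂ (edge G i) ≡ u →
          Reach G S (proj₁ (edge G i)) w → Reach G S u w

_─_ : ∀ {k} → Subset k → Fin k → Subset k
S ─ i = Data.Vec.updateAt S i (λ _ → false)

Connected : ∀ {n} (G : Graph n) → EdgeSet G → Set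
Connected G S = ∀ u v → Reach G S u v

-- S contains no cycle: no edge of S lies on a cycle of S, i.e. for every
-- edge i ∈ S, its endpoints are not joined by a walk in S − i.
Acyclic : ∀ {n} (G : Graph n) → EdgeSet G → Set
Acyclic G S = ∀ i → i ∈ S → ¬ Reach G (S ─ i) (proj₁ (edge G i)) (proj₂ (edge G i))

SpanningForest : ∀ {n} (G : Graph n) → EdgeSet G → Set
SpanningForest G F = Acyclic G F

SpanningTree : ∀ {n} (G : Graph n) → EdgeSet G → Set
SpanningTree G T = Connected G T × Acyclic G T

EdgeConnected : ℕ → ∀ {c} → Graph c → Set
EdgeConnected k H = ∀ (X : EdgeSet H) → ∣ X ∣ ℕ.< k → Connected H (∁ X)

TreeConnected : ℕ → ∀ {c} → Graph c → Set
TreeConnected k H =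
  Σ (Fin k → EdgeSet H) λ Ts →
    (∀ j → SpanningTree H (Ts j)) ×
    (∀ j j' → j ≢ j' → ∀ e → e ∈ Ts j → e ∉ Ts j')

-- Contraction G/F.
-- H (on vertex set Fin c) is G/F via the map φ sending each vertex of G
-- to the vertex of H representing its F-component: φ is surjective,
-- φ u ≡ φ v iff u and v lie in the same component of F, and the edges of
-- H are exactly the images of the edges of G whose endpoints lie in
-- different F-components (in the same order; edges inside a component
-- disappear).

IsContraction : ∀ {n c} (G : Graph n) (F : EdgeSet G) (φ : Fin n → Fin c) (H : Graph c) → Set
IsContraction G F φ H =
  Surjective _≡_ _≡_ φ ×
  (∀ u v → (φ u ≡ φ v) ⇔ Reach G F u v) ×
  (edges H ≡ map (λ e → φ (proj₁ e) , φ (proj₂ e))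
                 (filter (λ e → ¬? (φ (proj₁ e) ≟ φ (proj₂ e))) (edges G)))

ContractionHas : ∀ {n} (G : Graph n) (F : EdgeSet G) → (∀ {c} → Graph c → Set) → Set
ContractionHas G F P = Σ ℕ λ c → Σ (Fin _ → Fin c) λ φ → Σ (Graph c) λ H →
  IsContraction G F φ H × P H

⌊_/_⌋ : ℤ → (k : ℕ) → .{{NonZero k}} → ℤ
⌊ a / k ⌋ = a /ℕ k

⌈_/_⌉ : ℤ → (k : ℕ) → .{{NonZero k}} → ℤ
⌈ a / k ⌉ = - ((- a) /ℕ k)

module _ (k : ℕ) .{{_ : NonZero k}} {n} (G : Graph n) (F T : EdgeSet G) (v : Fin n) where
  private
    dT dG dF : ℤ
    dT = ℤ.+ deg G T v
    dG = ℤ.+ degG G v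
    dF = ℤ.+ deg G F v

  EdgeConnBound : Set
  EdgeConnBound = dT ℤ.≤ ⌈ dG ℤ.- dF ℤ.- ℤ.+ 2 / k ⌉ ℤ.+ dF ℤ.+ ℤ.+ 2

  TreeConnBound : Set
  TreeConnBound = dT ℤ.≤ ⌈ dG ℤ.- dF ℤ.- ℤ.+ 1 / k ⌉ ℤ.+ dF ℤ.+ ℤ.+ 1

  ReducedBound : Set
  ReducedBound = dT ℤ.≤ ⌊ dG ℤ.- dF / k ⌋ ℤ.+ dF

{-# OPTIONS --safe #-}
-- Let T ⊇ F be a spanning tree and w a vertex whose degree is to drop.  Delete from T the edges
-- outside F at w.  If an edge g of G joins two of the resulting components, and each component
-- can (recursively) be respanned so that the degree drops at its end of g, then adding g and
-- deleting an edge of T at w lowers the degree of w.  Otherwise the vertices blocking these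
-- changes form a set S ∋ w of vertices attaining their bounds, and every edge of G which is in F
-- or misses S has its ends joined by T after the deletion of the b edges of T ∖ F meeting S.
--
-- Let h be the degree in T minus the degree in F, and d the degree in G minus the degree in F.
-- If G/F contains k disjoint spanning trees, each of them crosses between the b + 1 components
-- at least b times.  If G/F is k-edge-connected, each of the at least b + 1 − |S| components
-- missing S sends at least k edges to S.  Since T has fewer than |S| edges inside S, either way
-- k Σ_S h ≤ Σ_S d + c (|S| − 1), where c = k − 1 or c = 2k − 2 respectively, and this is too
-- small for h to reach the bounds on S and exceed the one at w, even if the bound at a single
-- vertex is reduced to ⌊d/k⌋.
module Submission where

open import Defs
open import Data.Nat using
  (ℕ; zero; suc; NonZero; _+_; _*_; _∸_; _⊔_; _≤_; _<_; z≤n; s≤s; _/_; _%_; ≢-nonZero⁻¹)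
open import Data.Nat.Properties hiding (_≟_)
open import Data.Nat.ListAction using (sum)
open import Data.Nat.DivMod using (m≡m%n+[m/n]*n; m%n<n; m/n*n≤m; /-monoˡ-≤)
open import Data.Nat.Solver using () renaming (module +-*-Solver to NatSolver)
open import Data.Integer as ℤ using (ℤ)
import Data.Integer.Properties as ℤₚ
open import Data.Integer.DivMod using ([n/ℕd]*d≤n)
open import Data.Integer.Solver using () renaming (module +-*-Solver to IntSolver)
open import Data.Fin using (Fin; zero; suc)
open import Data.Fin.Properties using (_≟_; any?)
open import Data.Fin.Subset using (Subset; _∈_; _∉_; _⊆_; ∣_∣; ∁; ⁅_⁆) renaming (⊤ to full; ⊥ to empty)
open import Data.Fin.Subset.Properties using (_∈?_; x∈⁅x⁆; x∈⁅y⁆⇒x≡y; ∈⊤; x∈∁p⇒x∉p; ∣⊥∣≡0)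
open import Data.Bool using (true; false; if_then_else_; _∧_)
open import Data.List using (List; []; _∷_; _++_; length; map; filter; allFin; tabulate)
open import Data.List.Properties using (length-map; map-tabulate; ++-identityʳ; tabulate-lookup; length-++; length-tabulate)
open import Data.List.Membership.Propositional using () renaming (_∈_ to _∈ˡ_)
open import Data.List.Membership.Propositional.Properties
  using (∈-map⁺; ∈-map⁻; ∈-filter⁺; ∈-filter⁻; ∈-allFin; ∈-++⁺ˡ; ∈-++⁺ʳ; ∈-++⁻; ∈-lookup)
open import Data.List.Relation.Unary.Any using (here; there; index)
open import Data.List.Relation.Unary.Any.Properties using (lookup-index)
open import Data.List.Relation.Unary.All as All using (All; []; _∷_)
open import Data.List.Relation.Unary.AllPairs as AllPairs using (AllPairs; []; _∷_)
open import Data.List.Relation.Unary.Unique.Propositional.Properties using (allFin⁺; filter⁺)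
open import Data.Vec using (lookup; []; _∷_; here; there) renaming (tabulate to tabulateᵛ)
open import Data.Vec.Properties using ([]=⇒lookup; lookup⇒[]=; lookup∘tabulate; lookup∘updateAt; lookup∘updateAt′)
open import Data.Product using (Σ; ∃; _×_; _,_; proj₁; proj₂)
open import Data.Sum using (_⊎_; inj₁; inj₂; [_,_]′)
open import Data.Empty using (⊥; ⊥-elim)
open import Data.Unit using (⊤; tt)
open import Function using (_∘_; id; Equivalence)
open import Relation.Nullary using (Dec; yes; no; does; ¬_; ¬?; contradiction; _×-dec_; _⊎-dec_)
open import Relation.Nullary.Decidable using (map′; decidable-stable; dec-true)
open import Relation.Unary using (Pred; Decidable)
open import Relation.Binary.Core using (Rel)
open import Relation.Binary.PropositionalEquality
  using (_≡_; _≢_; refl; sym; trans; cong; cong₂; subst; subst₂; module ≡-Reasoning)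
open import Relation.Binary.Construct.Closure.Equivalence as Eq using (EqClosure)
open import Relation.Binary.Construct.Closure.ReflexiveTransitive using (ε; _◅_; _◅◅_)
import Relation.Binary.Construct.Closure.Symmetric as SC
open import Algebra.Properties.CommutativeMonoid.Sum +-0-commutativeMonoid
  using (∑-comm; ∑-distrib-+; sum-cong-≗) renaming (sum to ∑)
open import Level using (0ℓ)

private
  variable
    n : ℕ
    V : Set

-- Steinitz exchange for connectivity

module _ {V : Set} {R : Rel V 0ℓ} where

  ~-sym : ∀ {x y} → EqClosure R x y → EqClosure R y x
  ~-sym = Eq.symmetric R

  -- Connectivity after adding one link between `a` and `b`: a walk can be shortened until it
  -- crosses the link at most once, in one of its two directions.
  Through : V → V → Rel V 0ℓ
  Through a b u v = EqClosure R u v ⊎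
    (EqClosure R u a × EqClosure R b v ⊎ EqClosure R u b × EqClosure R a v)

  through-flip : ∀ {a b u v} → Through a b u v → Through b a u v
  through-flip (inj₁ p)        = inj₁ p
  through-flip (inj₂ (inj₁ p)) = inj₂ (inj₂ p)
  through-flip (inj₂ (inj₂ p)) = inj₂ (inj₁ p)

  through-step : ∀ {a b u w v} → EqClosure R u w → Through a b w v → Through a b u v
  through-step p (inj₁ q)              = inj₁ (p ◅◅ q)
  through-step p (inj₂ (inj₁ (q , r))) = inj₂ (inj₁ (p ◅◅ q , r))
  through-step p (inj₂ (inj₂ (q , r))) = inj₂ (inj₂ (p ◅◅ q , r))

  -- A walk that has just crossed the link and crosses it again is cut short, so a single crossing
  -- always remains enough.
  through-new : ∀ {a b v} → Through a b b v → Through a b a v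
  through-new (inj₁ q)              = inj₂ (inj₁ (ε , q))
  through-new (inj₂ (inj₁ (q , r))) = inj₁ (~-sym q ◅◅ r)
  through-new (inj₂ (inj₂ (q , r))) = inj₁ r

  split-at : ∀ {R' : Rel V 0ℓ} {a b} →
    (∀ {u v} → R' u v → EqClosure R u v ⊎ (a ≡ u × b ≡ v)) →
    ∀ {u v} → EqClosure R' u v → Through a b u v
  split-at {R'} {a} {b} f = go
    where
    step : ∀ {u v} → SC.SymClosure R' u v →
           EqClosure R u v ⊎ (a ≡ u × b ≡ v ⊎ b ≡ u × a ≡ v)
    step (SC.fwd r) with f r
    ... | inj₁ p = inj₁ p
    ... | inj₂ q = inj₂ (inj₁ q)
    step (SC.bwd r) with f r
    ... | inj₁ p       = inj₁ (~-sym p)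
    ... | inj₂ (q , s) = inj₂ (inj₂ (s , q))

    go : ∀ {u v} → EqClosure R' u v → Through a b u v
    go ε = inj₁ ε
    go (r ◅ rs) with step r
    ... | inj₁ p                    = through-step p (go rs)
    ... | inj₂ (inj₁ (refl , refl)) = through-new (go rs)
    ... | inj₂ (inj₂ (refl , refl)) = through-flip (through-new (through-flip (go rs)))

Linked : List (V × V) → Rel V 0ℓ
Linked L u v = (u , v) ∈ˡ L

Conn : List (V × V) → Rel V 0ℓ
Conn L = EqClosure (Linked L)

conn-⋆ : {L : List (V × V)} {R : Rel V 0ℓ} →
  (∀ {u v} → (u , v) ∈ˡ L → EqClosure R u v) → ∀ {u v} → Conn L u v → EqClosure R u v
conn-⋆ {R = R} = Eq._⋆

conn-⊆ : {L L' : List (V × V)} → (∀ {e} → e ∈ˡ L → e ∈ˡ L') → ∀ {u v} → Conn L u v → Conn L' u v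
conn-⊆ f = Eq.map f

conn-link : {L : List (V × V)} → ∀ {u v} → (u , v) ∈ˡ L → Conn L u v
conn-link = Eq.return

conn-split : ∀ {L : List (V × V)} {a b u v} → Conn ((a , b) ∷ L) u v → Through {R = Linked L} a b u v
conn-split = split-at λ { (here refl) → inj₂ (refl , refl) ; (there i) → inj₁ (conn-link i) }

conn-join : ∀ {L : List (V × V)} {a b u v} → Through {R = Linked L} a b u v → Conn ((a , b) ∷ L) u v
conn-join (inj₁ p)              = conn-⊆ there p
conn-join (inj₂ (inj₁ (p , q))) = conn-⊆ there p ◅◅ conn-link (here refl) ◅◅ conn-⊆ there q
conn-join (inj₂ (inj₂ (p , q))) = conn-⊆ there p ◅◅ ~-sym (conn-link (here refl)) ◅◅ conn-⊆ there q

-- Peeling off one pair turns the question into finitely many questions about a shorter list, so no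
-- enumeration of walks takes place.
conn? : (L : List (Fin n × Fin n)) → ∀ u v → Dec (Conn L u v)
conn? [] u v = map′ (λ { refl → ε }) (λ { ε → refl ; (SC.fwd () ◅ _) ; (SC.bwd () ◅ _) }) (u ≟ v)
conn? ((a , b) ∷ L) u v = map′ conn-join conn-split
  (conn? L u v ⊎-dec ((conn? L u a ×-dec conn? L b v) ⊎-dec (conn? L u b ×-dec conn? L a v)))

-- Independence in the graphic matroid contracted by `L`, tested one entry at a time; entries
-- already tested move into `L`.
Independent : List (V × V) → List (V × V) → Set
Independent L []             = ⊤
Independent L ((a , b) ∷ bs) = ¬ Conn L a b × Independent ((a , b) ∷ L) bs

private
  Spans : List (V × V) → List (V × V) → Set
  Spans L K = ∀ {e} → e ∈ˡ K → Conn L (proj₁ e) (proj₂ e)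

spans-conn : {L K : List (V × V)} → Spans L K → ∀ {u v} → Conn K u v → Conn L u v
spans-conn f = conn-⋆ (λ i → f i)

-- Entries of `D` are passed over from the front as long as the rest still joins `a` to `b`. The
-- first entry for which this fails is the one that `(a , b)` can replace.
exchange : ∀ (L D : List (Fin n × Fin n)) {a b} → ¬ Conn L a b → Conn (D ++ L) a b →
  ∃ λ D' → length D ≡ suc (length D') × Spans (D' ++ (a , b) ∷ L) (D ++ L)
exchange L [] ¬p p = contradiction p ¬p
exchange L ((c , d) ∷ D) {a} {b} ¬p p with conn? (D ++ L) a b
... | yes q with D' , eq , sp ← exchange L D ¬p q =
  (c , d) ∷ D' , cong suc eq ,
  λ { (here refl) → conn-link (here refl) ; (there i) → conn-⊆ there (sp i) }
... | no ¬q = D , refl , sp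
  where
  M = D ++ (a , b) ∷ L

  old : ∀ {u v} → Conn (D ++ L) u v → Conn M u v
  old = conn-⊆ λ i → [ ∈-++⁺ˡ , ∈-++⁺ʳ D ∘ there ]′ (∈-++⁻ D i)

  new : Conn M a b
  new = conn-link (∈-++⁺ʳ D (here refl))

  sp : Spans M ((c , d) ∷ D ++ L)
  sp (there i) = old (conn-link i)
  -- Every walk from `a` to `b` crosses `(c , d)`; its two remaining pieces together with the new
  -- link join `c` to `d`.
  sp (here refl) with conn-split p
  ... | inj₁ q = contradiction q ¬q
  ... | inj₂ (inj₁ (q , r)) = ~-sym (old q) ◅◅ new ◅◅ ~-sym (old r)
  ... | inj₂ (inj₂ (q , r)) = old r ◅◅ ~-sym new ◅◅ old q

-- Each entry of `B` in turn uses up one entry of `D` and joins `L`, so `D` cannot run out before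
-- `B`.
steinitz : ∀ (L B D : List (Fin n × Fin n)) → Independent L B → Spans (D ++ L) B →
  length B ≤ length D
steinitz L [] D ind sp = z≤n
steinitz L ((a , b) ∷ B) D (¬p , ind) sp with exchange L D ¬p (sp (here refl))
... | D' , eq , sp' = subst (suc (length B) ≤_) (sym eq)
  (s≤s (steinitz ((a , b) ∷ L) B D' ind (λ i → spans-conn (λ j → sp' j) (sp (there i)))))

-- Counting

private
  variable
    l : ℕ

∸-strict : ∀ {a b c} → a < b → c < b → a ∸ c < b ∸ c
∸-strict {a} {b} {c} a<b c<b with ≤-total c a
... | inj₁ c≤a = ∸-monoˡ-< a<b c≤a
... | inj₂ a≤c rewrite m≤n⇒m∸n≡0 a≤c = m<n⇒0<n∸m c<b

-- For the potential of the descent: with `a` the new degree, `b` the old one and `c` the target,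
-- growth up to the target creates no excess.
⊔-∸ : ∀ {a b c} → a ≤ b ⊔ c → a ∸ c ≤ b ∸ c
⊔-∸ {a} {b} {c} le = begin
  a ∸ c             ≤⟨ ∸-monoˡ-≤ c le ⟩
  (b ⊔ c) ∸ c       ≡⟨ ∸-distribʳ-⊔ c b c ⟩
  (b ∸ c) ⊔ (c ∸ c) ≡⟨ cong ((b ∸ c) ⊔_) (n∸n≡0 c) ⟩
  (b ∸ c) ⊔ 0       ≡⟨ ⊔-identityʳ _ ⟩
  b ∸ c             ∎
  where open ≤-Reasoning

∑-mono : {f g : Fin l → ℕ} → (∀ i → f i ≤ g i) → ∑ f ≤ ∑ g
∑-mono {zero}  h = z≤n
∑-mono {suc l} h = +-mono-≤ (h zero) (∑-mono (h ∘ suc))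

∑-mono-< : {f g : Fin l → ℕ} → (∀ i → f i ≤ g i) → ∀ j → f j < g j → ∑ f < ∑ g
∑-mono-< h zero    lt = +-mono-<-≤ lt (∑-mono (h ∘ suc))
∑-mono-< h (suc j) lt = +-mono-≤-< (h zero) (∑-mono-< (h ∘ suc) j lt)

∑-zero : (f : Fin l → ℕ) → (∀ i → f i ≡ 0) → ∑ f ≡ 0
∑-zero {zero}  f h = refl
∑-zero {suc l} f h = cong₂ _+_ (h zero) (∑-zero (f ∘ suc) (h ∘ suc))

*-∑ : ∀ c (f : Fin l → ℕ) → c * ∑ f ≡ ∑ (λ i → c * f i)
*-∑ {zero}  c f = *-zeroʳ c
*-∑ {suc l} c f = trans (*-distribˡ-+ c (f zero) _) (cong (c * f zero +_) (*-∑ c (f ∘ suc)))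

∑-tabulate : (f : Fin l → ℕ) → sum (tabulate f) ≡ ∑ f
∑-tabulate {zero}  f = refl
∑-tabulate {suc l} f = cong (f zero +_) (∑-tabulate (f ∘ suc))

ind : {A : Set} → Dec A → ℕ
ind a? = if does a? then 1 else 0

module _ {A : Set} where

  ind-≤1 : (a? : Dec A) → ind a? ≤ 1
  ind-≤1 (yes _) = ≤-refl
  ind-≤1 (no _)  = z≤n

  ind-yes : (a? : Dec A) → A → ind a? ≡ 1
  ind-yes (yes _) a = refl
  ind-yes (no ¬a) a = contradiction a ¬a

  ind-no : (a? : Dec A) → ¬ A → ind a? ≡ 0
  ind-no (yes a) ¬a = contradiction a ¬a
  ind-no (no _)  ¬a = refl

module _ {A B : Set} where

  ind-mono : (A → B) → (a? : Dec A) (b? : Dec B) → ind a? ≤ ind b?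
  ind-mono f (no _)  b? = z≤n
  ind-mono f (yes a) b? = ≤-reflexive (sym (ind-yes b? (f a)))

  ind-× : (a? : Dec A) (b? : Dec B) → ind (a? ×-dec b?) ≡ ind a? * ind b?
  ind-× (yes _) (yes _) = refl
  ind-× (yes _) (no _)  = refl
  ind-× (no _)  _       = refl

  ind-⊎-× : (a? : Dec A) (b? : Dec B) → ind a? + ind b? ≡ ind (a? ⊎-dec b?) + ind (a? ×-dec b?)
  ind-⊎-× (yes _) (yes _) = refl
  ind-⊎-× (yes _) (no _)  = refl
  ind-⊎-× (no _)  (yes _) = refl
  ind-⊎-× (no _)  (no _)  = refl

ind-cong : {A B : Set} → (A → B) → (B → A) → (a? : Dec A) (b? : Dec B) → ind a? ≡ ind b?
ind-cong f g a? b? = ≤-antisym (ind-mono f a? b?) (ind-mono g b? a?)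

module _ {A B C : Set} where

  ind-cover : (C → A ⊎ B) → (a? : Dec A) (b? : Dec B) (c? : Dec C) → ind c? ≤ ind a? + ind b?
  ind-cover f a? b? (no _)  = z≤n
  ind-cover f a? b? (yes c) with f c
  ... | inj₁ a = ≤-trans (≤-reflexive (sym (ind-yes a? a))) (m≤m+n _ _)
  ... | inj₂ b = ≤-trans (≤-reflexive (sym (ind-yes b? b))) (m≤n+m _ _)

  ind-pack : (A → C) → (B → C) → (A → ¬ B) →
    (a? : Dec A) (b? : Dec B) (c? : Dec C) → ind a? + ind b? ≤ ind c?
  ind-pack f g h (no _)  b? c? = ind-mono g b? c?
  ind-pack f g h (yes a) b? c? rewrite ind-no b? (h a) = ≤-reflexive (sym (ind-yes c? (f a)))

count : {P : Pred (Fin l) 0ℓ} → Decidable P → ℕ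
count P? = ∑ (λ i → ind (P? i))

module _ {P Q : Pred (Fin l) 0ℓ} {P? : Decidable P} {Q? : Decidable Q} where

  count-mono : (∀ {i} → P i → Q i) → count P? ≤ count Q?
  count-mono f = ∑-mono λ i → ind-mono f (P? i) (Q? i)

  count-cong : (∀ {i} → P i → Q i) → (∀ {i} → Q i → P i) → count P? ≡ count Q?
  count-cong f g = sum-cong-≗ λ i → ind-cong f g (P? i) (Q? i)

  count-mono-< : (∀ {i} → P i → Q i) → ∀ j → ¬ P j → Q j → count P? < count Q?
  count-mono-< f j ¬p q = ∑-mono-< (λ i → ind-mono f (P? i) (Q? i)) j
    (subst₂ _<_ (sym (ind-no (P? j) ¬p)) (sym (ind-yes (Q? j) q)) ≤-refl)

module _ {P Q R : Pred (Fin l) 0ℓ} {P? : Decidable P} {Q? : Decidable Q} {R? : Decidable R} where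

  count-cover : (∀ {i} → R i → P i ⊎ Q i) → count R? ≤ count P? + count Q?
  count-cover f = ≤-trans (∑-mono λ i → ind-cover f (P? i) (Q? i) (R? i))
    (≤-reflexive (∑-distrib-+ (λ i → ind (P? i)) (λ i → ind (Q? i))))

  count-pack : (∀ {i} → P i → R i) → (∀ {i} → Q i → R i) → (∀ {i} → P i → ¬ Q i) →
    count P? + count Q? ≤ count R?
  count-pack f g h = ≤-trans
    (≤-reflexive (sym (∑-distrib-+ (λ i → ind (P? i)) (λ i → ind (Q? i)))))
    (∑-mono λ i → ind-pack f g h (P? i) (Q? i) (R? i))

count-≡ : (j : Fin l) → count (_≟ j) ≡ 1
count-≡ {suc l} zero    = cong suc (∑-zero {l} _ λ i → refl)
count-≡ {suc l} (suc j) = trans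
  (sum-cong-≗ {l} λ i → ind-cong (λ { refl → refl }) (λ { refl → refl }) (suc i ≟ suc j) (i ≟ j)) (count-≡ j)

-- Induction that removes `P x` from `Q` for one index at a time; disjointness keeps the later
-- families inside what is left.
count-packing : ∀ {I : Set} k {P : I → Pred (Fin l) 0ℓ} (P? : ∀ x → Decidable (P x)) {xs : List I} →
  AllPairs (λ x y → ∀ {i} → P x i → ¬ P y i) xs → All (λ x → k ≤ count (P? x)) xs →
  ∀ {Q : Pred (Fin l) 0ℓ} (Q? : Decidable Q) → (∀ {x i} → x ∈ˡ xs → P x i → Q i) →
  k * length xs ≤ count Q?
count-packing k P? [] [] Q? f = subst (_≤ count Q?) (sym (*-zeroʳ k)) z≤n
count-packing k {P} P? {x ∷ xs} (d ∷ ds) (h ∷ hs) {Q} Q? f = begin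
  k * suc (length xs)      ≡⟨ *-suc k _ ⟩
  k + k * length xs        ≤⟨ +-mono-≤ h (count-packing k P? ds hs Q'?
                                λ i p → f (there i) p , λ p' → All.lookup d i p' p) ⟩
  count (P? x) + count Q'? ≤⟨ count-pack {P? = P? x} {Q? = Q'?} {R? = Q?} (f (here refl)) proj₁ (λ p q → proj₂ q p) ⟩
  count Q?                 ∎
  where
  open ≤-Reasoning
  Q'? : Decidable (λ i → Q i × ¬ P x i)
  Q'? i = Q? i ×-dec ¬? (P? x i)

length-filter-tabulate : ∀ {I : Set} {P : Pred I 0ℓ} (P? : Decidable P) (f : Fin l → I) →
  length (filter P? (tabulate f)) ≡ count (P? ∘ f)
length-filter-tabulate {zero}  P? f = refl
length-filter-tabulate {suc l} P? f with P? (f zero)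
... | yes _ = cong suc (length-filter-tabulate P? (f ∘ suc))
... | no _  = length-filter-tabulate P? (f ∘ suc)

length-filter-allFin : {P : Pred (Fin l) 0ℓ} (P? : Decidable P) → length (filter P? (allFin l)) ≡ count P?
length-filter-allFin P? = length-filter-tabulate P? id

⟪_⟫ : {P : Pred (Fin l) 0ℓ} → Decidable P → Subset l
⟪ P? ⟫ = tabulateᵛ (does ∘ P?)

module _ {P : Pred (Fin l) 0ℓ} {P? : Decidable P} where

  ∈⟪⟫⁺ : ∀ {i} → P i → i ∈ ⟪ P? ⟫
  ∈⟪⟫⁺ {i} p = lookup⇒[]= i _ (trans (lookup∘tabulate (does ∘ P?) i) (dec-true (P? i) p))

  ∈⟪⟫⁻ : ∀ {i} → i ∈ ⟪ P? ⟫ → P i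
  ∈⟪⟫⁻ {i} q with P? i | trans (sym (lookup∘tabulate (does ∘ P?) i)) ([]=⇒lookup q)
  ... | yes p | _ = p

∣∣≡count : (S : Subset l) → ∣ S ∣ ≡ count (_∈? S)
∣∣≡count {zero}  []          = refl
∣∣≡count {suc l} (true ∷ S)  = cong suc (trans (∣∣≡count S)
  (sum-cong-≗ {l} λ i → ind-cong there (λ { (there p) → p }) (i ∈? S) (suc i ∈? (true ∷ S))))
∣∣≡count {suc l} (false ∷ S) = trans (∣∣≡count S)
  (sum-cong-≗ {l} λ i → ind-cong there (λ { (there p) → p }) (i ∈? S) (suc i ∈? (false ∷ S)))

-- Connectivity in edge sets of a graph

module Joining {n : ℕ} (G : Graph n) where

  Edge : Set
  Edge = Fin (m G)

  src tgt : Edge → Fin n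
  src i = proj₁ (edge G i)
  tgt i = proj₂ (edge G i)

  Link : Pred Edge 0ℓ → Rel (Fin n) 0ℓ
  Link P u v = ∃ λ i → P i × src i ≡ u × tgt i ≡ v

  Joined : Pred Edge 0ℓ → Rel (Fin n) 0ℓ
  Joined P = EqClosure (Link P)

  Closes : Pred Edge 0ℓ → Pred Edge 0ℓ
  Closes P i = Joined P (src i) (tgt i)

  Inc : Edge → Fin n → Set
  Inc i v = src i ≡ v ⊎ tgt i ≡ v

  inc? : ∀ i v → Dec (Inc i v)
  inc? i v = (src i ≟ v) ⊎-dec (tgt i ≟ v)

  _−_ : Pred Edge 0ℓ → Edge → Pred Edge 0ℓ
  (P − e) i = P i × i ≢ e

  module _ {P : Pred Edge 0ℓ} where

    closes : ∀ {i} → P i → Closes P i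
    closes {i} p = Eq.return (i , p , refl , refl)

    joined-⋆ : ∀ {Q : Pred Edge 0ℓ} → (∀ {i} → P i → Closes Q i) → ∀ {u v} → Joined P u v → Joined Q u v
    joined-⋆ f = Eq._⋆ λ { (i , p , refl , refl) → f p }

    joined-⊆ : ∀ {Q : Pred Edge 0ℓ} → (∀ {i} → P i → Q i) → ∀ {u v} → Joined P u v → Joined Q u v
    joined-⊆ f = joined-⋆ λ p → Eq.return (_ , f p , refl , refl)

    joined-sym : ∀ {u v} → Joined P u v → Joined P v u
    joined-sym = ~-sym

    joined-split : ∀ {u v} → Joined P u v → ∀ e → Through {R = Link (P − e)} (src e) (tgt e) u v
    joined-split p e = split-at f p
      where
      f : ∀ {u v} → Link P u v → EqClosure (Link (P − e)) u v ⊎ (src e ≡ u × tgt e ≡ v)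
      f (i , q , refl , refl) with i ≟ e
      ... | yes refl = inj₂ (refl , refl)
      ... | no ≢e    = inj₁ (Eq.return (i , (q , ≢e) , refl , refl))

    -- A walk never leaves its component. This confines walks to a single part, where they can be
    -- rerouted or shown to avoid an edge elsewhere.
    joined-within : ∀ {x u v} → Joined P x u → Joined P u v →
      Joined (λ i → P i × Joined P x (src i) × Joined P x (tgt i)) u v
    joined-within p ε = ε
    joined-within p (SC.fwd (i , q , refl , refl) ◅ rs) =
      SC.fwd (i , (q , p , p') , refl , refl) ◅ joined-within p' rs
      where p' = p ◅◅ closes q
    joined-within p (SC.bwd (i , q , refl , refl) ◅ rs) =
      SC.bwd (i , (q , p' , p) , refl , refl) ◅ joined-within p' rs
      where p' = p ◅◅ joined-sym (closes q)

    module _ (P? : Decidable P) where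

      edgeList : List (Fin n × Fin n)
      edgeList = map (edge G) (filter P? (allFin (m G)))

      joined⇒conn : ∀ {u v} → Joined P u v → Conn edgeList u v
      joined⇒conn = Eq._⋆ λ { (i , p , refl , refl) →
        conn-link (∈-map⁺ (edge G) (∈-filter⁺ P? (∈-allFin i) p)) }

      conn⇒joined : ∀ {u v} → Conn edgeList u v → Joined P u v
      conn⇒joined = conn-⋆ link
        where
        link : ∀ {u v} → (u , v) ∈ˡ edgeList → Joined P u v
        link j with ∈-map⁻ (edge G) j
        ... | i , k , refl = closes (proj₂ (∈-filter⁻ P? {xs = allFin (m G)} k))

      joined? : ∀ u v → Dec (Joined P u v)
      joined? u v = map′ conn⇒joined joined⇒conn (conn? edgeList u v)

  module _ {Q P D : Pred Edge 0ℓ} (P⊆Q : ∀ {i} → P i → Q i) (P? : Decidable P) (D? : Decidable D)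
    (bridge : ∀ {e} → Q e → D e → ¬ Closes (Q − e) e) where

    -- The edges in D are bridges of Q, so they can be deleted from P one at a time.
    joined-avoid : ∀ {x y} → Joined P x y → (∀ {e} → Q e → D e → Joined (Q − e) x y) →
      Joined (λ i → P i × ¬ D i) x y
    joined-avoid {x} {y} p h = joined-⊆
      (λ { {i} (q , ∉) → q , λ d → ∉ (∈-filter⁺ D? (∈-allFin i) d) })
      (go _ λ i → proj₂ (∈-filter⁻ D? {xs = allFin (m G)} i))
      where
      weaken : ∀ {es e u v} → Joined ((λ i → P i × ¬ i ∈ˡ es) − e) u v → Joined (Q − e) u v
      weaken = joined-⊆ λ { ((pi , _) , ≢e) → P⊆Q pi , ≢e }

      go : ∀ es → (∀ {e} → e ∈ˡ es → D e) → Joined (λ i → P i × ¬ i ∈ˡ es) x y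
      go [] _ = joined-⊆ (λ q → q , λ ()) p
      go (e ∷ es) ds with go es (ds ∘ there) | P? e
      ... | q | no ¬pe = joined-⊆
        (λ { (pi , ∉) → pi , λ { (here refl) → ¬pe pi ; (there j) → ∉ j } }) q
      ... | q | yes pe with joined-split q e
      ... | inj₁ r = joined-⊆ (λ { ((pi , ∉) , ≢e) → pi , λ { (here eq) → ≢e eq ; (there j) → ∉ j } }) r
      -- If the walk had to cross `e`, its two pieces and the walk from `x` to `y` in `Q − e` would
      -- join the ends of `e` in `Q − e`, against `bridge`.
      ... | inj₂ (inj₁ (r , s)) = contradiction
        (joined-sym (weaken {es} r) ◅◅ h (P⊆Q pe) (ds (here refl)) ◅◅ joined-sym (weaken {es} s))
        (bridge (P⊆Q pe) (ds (here refl)))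
      ... | inj₂ (inj₂ (r , s)) = contradiction
        (weaken {es} s ◅◅ joined-sym (h (P⊆Q pe) (ds (here refl))) ◅◅ weaken {es} r)
        (bridge (P⊆Q pe) (ds (here refl)))

  module _ {P D : Pred Edge 0ℓ} (P? : Decidable P) (D? : Decidable D)
    (bridge : ∀ {e} → P e → D e → ¬ Closes (P − e) e) where

    -- Contrapositive of `joined-avoid`: if each edge of `D` could be avoided singly, all of them
    -- could be avoided together.
    separating-edge : ∀ {x y} → Joined P x y → ¬ Joined (λ i → P i × ¬ D i) x y →
      ∃ λ e → P e × D e × ¬ Joined (P − e) x y
    separating-edge {x} {y} p ¬q
      with any? (λ e → P? e ×-dec D? e ×-dec ¬? (joined? (λ i → P? i ×-dec ¬? (i ≟ e)) x y))
    ... | yes found = found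
    ... | no none = contradiction
      (joined-avoid id P? D? bridge p λ {e} pe de → decidable-stable (joined? (λ i → P? i ×-dec ¬? (i ≟ e)) x y)
        λ ¬r → none (e , pe , de , ¬r)) ¬q

  degree : Subset (m G) → Fin n → ℕ
  degree U v = count λ i → (i ∈? U) ×-dec inc? i v

-- Reducing the degree at one vertex

module Touching {n : ℕ} (G : Graph n) (F : EdgeSet G) where

  open Joining G

  -- Edges of `F` are excluded because they must stay in the tree and are never exchanged.
  record Touch (S : Pred (Fin n) 0ℓ) (i : Edge) : Set where
    constructor touching
    field
      i∉F   : i ∉ F
      meets : S (src i) ⊎ S (tgt i)

  open Touch public

  touch? : ∀ {S} → Decidable S → Decidable (Touch S)
  touch? S? i = map′ (λ (i∉F , r) → touching i∉F r) (λ t → i∉F t , meets t)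
    (¬? (i ∈? F) ×-dec (S? (src i) ⊎-dec S? (tgt i)))

  touch-mono : ∀ {R S : Pred (Fin n) 0ℓ} → (∀ {v} → R v → S v) → ∀ {i} → Touch R i → Touch S i
  touch-mono f (touching ∉F (inj₁ r)) = touching ∉F (inj₁ (f r))
  touch-mono f (touching ∉F (inj₂ r)) = touching ∉F (inj₂ (f r))

  touch-at : ∀ {S : Pred (Fin n) 0ℓ} {i v} → i ∉ F → S v → Inc i v → Touch S i
  touch-at ∉F s (inj₁ refl) = touching ∉F (inj₁ s)
  touch-at ∉F s (inj₂ refl) = touching ∉F (inj₂ s)

  outside? : ∀ (U : EdgeSet G) → Decidable (λ i → i ∈ U × i ∉ F)
  outside? U i = (i ∈? U) ×-dec ¬? (i ∈? F)

  extra : EdgeSet G → Fin n → ℕ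
  extra U v = count λ i → outside? U i ×-dec inc? i v

  degree-split : ∀ {U} → F ⊆ U → ∀ v → degree U v ≡ degree F v + extra U v
  degree-split {U} F⊆U v = ≤-antisym
    (count-cover {P? = in-F?} {Q? = out-F?} {R? = in-U?} split)
    (count-pack {P? = in-F?} {Q? = out-F?} {R? = in-U?} (λ (f , e) → F⊆U f , e) (λ ((u , _) , e) → u , e)
      λ (f , _) ((_ , ∉F) , _) → ∉F f)
    where
    in-F? : Decidable (λ i → i ∈ F × Inc i v)
    in-F? i = (i ∈? F) ×-dec inc? i v
    out-F? : Decidable (λ i → (i ∈ U × i ∉ F) × Inc i v)
    out-F? i = outside? U i ×-dec inc? i v
    in-U? : Decidable (λ i → i ∈ U × Inc i v)
    in-U? i = (i ∈? U) ×-dec inc? i v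
    split : ∀ {i} → i ∈ U × Inc i v → i ∈ F × Inc i v ⊎ (i ∈ U × i ∉ F) × Inc i v
    split {i} (u , e) with i ∈? F
    ... | yes f = inj₁ (f , e)
    ... | no ∉F = inj₂ ((u , ∉F) , e)

module Reduction {n : ℕ} (G : Graph n) (F T : EdgeSet G) (F⊆T : F ⊆ T)
  (bridge : ∀ {e} → e ∈ T → ¬ Joining.Closes G (λ i → i ∈ T × i ≢ e) e)
  (H : Fin n → ℕ) (T≤H : ∀ v → Joining.degree G T v ≤ H v) where

  open Joining G
  open Touching G F

  T[_] : Pred Edge 0ℓ → Pred Edge 0ℓ
  T[ K ] i = i ∈ T × K i

  -- A change confined to `K`, so that changes in disjoint parts can be combined. `T'` may contain
  -- cycles; pruning removes them later and only lowers degrees.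
  record Improvement (K : Pred Edge 0ℓ) (w : Fin n) : Set where
    field
      T'      : EdgeSet G
      F⊆T'    : F ⊆ T'
      out⇒T   : ∀ {i} → ¬ K i → i ∈ T' → i ∈ T
      T⇒out   : ∀ {i} → ¬ K i → i ∈ T → i ∈ T'
      rejoin  : ∀ {i} → i ∈ T → K i → Closes (λ j → j ∈ T' × K j) i
      bounded : ∀ v → degree T' v ≤ H v
      strict  : degree T' w < H w

  -- What a failed search leaves behind. In `blocked` the tree edges at `S` are deleted one at a
  -- time; since they are bridges, `joined-avoid` later turns this into deleting all of them at
  -- once.
  record Obstruction (K : Pred Edge 0ℓ) (w : Fin n) : Set where
    field
      S       : Subset n
      w∈S     : w ∈ S
      tight   : ∀ {v} → v ∈ S → degree T v ≡ H v
      near    : ∀ {v} → v ∈ S → Joined T[ K ] w v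
      blocked : ∀ {g} → K g → ¬ Touch (_∈ S) g → ∀ {e} → e ∈ T → Touch (_∈ S) e →
                Closes ((_∈ T) − e) g

  Outcome : Pred Edge 0ℓ → Fin n → Set
  Outcome K w = Improvement K w ⊎ Obstruction K w

  Blocks : ∀ {K w} → Outcome K w → Pred (Fin n) 0ℓ
  Blocks (inj₁ _) v = ⊥
  Blocks (inj₂ o) v = v ∈ Obstruction.S o

  blocks? : ∀ {K w} (r : Outcome K w) → Decidable (Blocks r)
  blocks? (inj₁ _) v = no λ ()
  blocks? (inj₂ o) v = v ∈? Obstruction.S o

  blocks-tight : ∀ {K w} (r : Outcome K w) {v} → Blocks r v → degree T v ≡ H v
  blocks-tight (inj₂ o) = Obstruction.tight o

  blocks-near : ∀ {K w} (r : Outcome K w) {v} → Blocks r v → Joined T[ K ] w v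
  blocks-near (inj₂ o) = Obstruction.near o

  blocks-blocked : ∀ {K w} (r : Outcome K w) {g} → K g → ¬ Touch (Blocks r) g →
    ∀ {e} → e ∈ T → Touch (Blocks r) e → Closes ((_∈ T) − e) g
  blocks-blocked (inj₁ _) _ _ _ (touching _ (inj₁ ()))
  blocks-blocked (inj₁ _) _ _ _ (touching _ (inj₂ ()))
  blocks-blocked (inj₂ o) = Obstruction.blocked o

  improvement : ∀ {K w} (r : Outcome K w) → ¬ Blocks r w → Improvement K w
  improvement (inj₁ a) _ = a
  improvement (inj₂ o) h = contradiction (Obstruction.w∈S o) h

  unchanged : ∀ {K w} → degree T w < H w → Improvement K w
  unchanged lt = record
    { T' = T ; F⊆T' = F⊆T ; out⇒T = λ _ t → t ; T⇒out = λ _ t → t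
    ; rejoin = λ t k → closes (t , k) ; bounded = T≤H ; strict = lt }

  singleton-obstruction : ∀ {K w} → (∀ {g} → K g → Closes T[ K ] g) → degree T w ≡ H w →
    ¬ (∃ λ e → e ∈ T × K e × Touch (_≡ w) e) → Obstruction K w
  singleton-obstruction {K} {w} inv eq none = record
    { S = ⁅ w ⁆ ; w∈S = x∈⁅x⁆ w
    ; tight = λ v∈ → subst (λ v → degree T v ≡ H v) (sym (x∈⁅y⁆⇒x≡y w v∈)) eq
    ; near = λ v∈ → subst (Joined T[ K ] w) (sym (x∈⁅y⁆⇒x≡y w v∈)) ε
    ; blocked = λ kg _ {e} te touch → joined-⊆
        (λ { (tj , kj) → tj , λ { refl → none (e , te , kj , touch-mono (x∈⁅y⁆⇒x≡y w) touch) } })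
        (inv kg) }

  module Step {K : Pred Edge 0ℓ} (K? : Decidable K) (inv : ∀ {g} → K g → Closes T[ K ] g)
    (w : Fin n) (tight-w : degree T w ≡ H w) where

    P : Pred Edge 0ℓ
    P i = T[ K ] i × ¬ Touch (_≡ w) i

    P? : Decidable P
    P? i = ((i ∈? T) ×-dec K? i) ×-dec ¬? (touch? (_≟ w) i)

    -- The ground set of the recursive call at `x`: all edges of `K`, in the tree or not, within one
    -- component left after the deletion at `w`.
    Part : Fin n → Pred Edge 0ℓ
    Part x i = K i × Joined P x (src i) × Joined P x (tgt i)

    part? : ∀ x → Decidable (Part x)
    part? x i = K? i ×-dec joined? P? x (src i) ×-dec joined? P? x (tgt i)

    part-inv : ∀ x {g} → Part x g → Closes T[ Part x ] g
    part-inv x (_ , p , q) = joined-⊆ (λ { (((t , k) , _) , r) → t , k , r })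
      (joined-within p (joined-sym p ◅◅ q))

    P⊆T−e : ∀ {e} → Touch (_≡ w) e → ∀ {u v} → Joined P u v → Joined ((_∈ T) − e) u v
    P⊆T−e te = joined-⊆ λ { ((t , _) , ¬touch) → t , λ { refl → ¬touch te } }

    -- Otherwise `P`, which omits `e`, would join the ends of a bridge. Hence every part has fewer
    -- tree edges than `K`, and the recursion ends.
    touch∉part : ∀ {e} → e ∈ T → Touch (_≡ w) e → ∀ x → ¬ Part x e
    touch∉part t te x (_ , p , q) = bridge t (P⊆T−e te (joined-sym p ◅◅ q))

    part-joined : ∀ {x i} → Part x i → ∀ {v} → Inc i v → Joined P x v
    part-joined (_ , p , _) (inj₁ refl) = p
    part-joined (_ , _ , q) (inj₂ refl) = q

    module Combine (res : ∀ x → Outcome (Part x) x) where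

      -- Only starting points that the tree reaches from `w` inside `K` contribute, which keeps all
      -- of `S` near `w`.
      S : Pred (Fin n) 0ℓ
      S v = v ≡ w ⊎ ∃ λ x → Joined T[ K ] w x × Blocks (res x) v

      TK? : Decidable T[ K ]
      TK? i = (i ∈? T) ×-dec K? i

      S? : Decidable S
      S? v = (v ≟ w) ⊎-dec any? λ x → joined? TK? w x ×-dec blocks? (res x) v

      blocks-P : ∀ x {v} → Blocks (res x) v → Joined P x v
      blocks-P x b = joined-⋆ (λ { (_ , _ , p , q) → joined-sym p ◅◅ q }) (blocks-near (res x) b)

      tight : ∀ {v} → S v → degree T v ≡ H v
      tight (inj₁ refl)        = tight-w
      tight (inj₂ (x , _ , b)) = blocks-tight (res x) b

      near : ∀ {v} → S v → Joined T[ K ] w v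
      near (inj₁ refl)        = ε
      near (inj₂ (x , p , b)) = p ◅◅ joined-⊆ proj₁ (blocks-P x b)

      -- The walk closing `g` stays in a component of `P` other than that of `x`, whereas `e` has an
      -- end in the latter.
      part-avoids : ∀ x {g} → ¬ Part x g → K g → Closes P g → ∀ {e v} → Blocks (res x) v → Inc e v →
        Closes ((_∈ T) − e) g
      part-avoids x ¬part kg p {e} b e∋v = joined-⊆
        (λ { (((t , _) , _) , s , s') → t , λ { refl → ¬part (kg , from s s' , from s s' ◅◅ p) } })
        (joined-within ε p)
        where
        from : ∀ {u} → Joined P u (src e) → Joined P u (tgt e) → Joined P x u
        from s s' = blocks-P x b ◅◅ joined-sym ([ (λ { refl → s }) , (λ { refl → s' }) ]′ e∋v)

      blocked : ∀ {g} → K g → ¬ Touch S g → Closes P g → ∀ {e} → e ∈ T → Touch S e →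
        Closes ((_∈ T) − e) g
      blocked {g} kg ¬tg p {e} te (touching ∉F s) =
        [ (λ r → at r (inj₁ refl)) , (λ r → at r (inj₂ refl)) ]′ s
        where
        at : ∀ {v} → S v → Inc e v → Closes ((_∈ T) − e) g
        at (inj₁ v≡w) e∋v = P⊆T−e (touch-at ∉F v≡w e∋v) p
        at (inj₂ (x , q , b)) e∋v with part? x g
        -- The blocking set of the recursive call at `x` is contained in `S`, so `g` misses it too.
        ... | yes part = blocks-blocked (res x) part
          (¬tg ∘ touch-mono (λ b → inj₂ (x , q , b))) te (touch-at ∉F b e∋v)
        ... | no ¬part = part-avoids x ¬part kg p {e} b e∋v

      obstruction : (∀ {g} → K g → ¬ Touch S g → g ∉ F → Closes P g) → Obstruction K w
      obstruction ok = record
        { S = ⟪ S? ⟫ ; w∈S = ∈⟪⟫⁺ {P? = S?} (inj₁ refl)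
        ; tight = λ v∈ → tight (∈⟪⟫⁻ {P? = S?} v∈)
        ; near = λ v∈ → near (∈⟪⟫⁻ {P? = S?} v∈)
        ; blocked = λ {g} kg ¬tg {e} te touch →
            blocked′ kg (¬tg ∘ touch-mono (∈⟪⟫⁺ {P? = S?})) te (touch-mono (∈⟪⟫⁻ {P? = S?}) touch) }
        where
        blocked′ : ∀ {g} → K g → ¬ Touch S g → ∀ {e} → e ∈ T → Touch S e → Closes ((_∈ T) − e) g
        blocked′ {g} kg ¬tg te touch with g ∈? F
        -- An edge of `F` lies in the tree and differs from `e`, which is outside `F`, so it closes
        -- itself.
        ... | yes g∈F = closes (F⊆T g∈F , λ { refl → i∉F touch g∈F })
        ... | no g∉F  = blocked kg ¬tg (ok kg ¬tg g∉F) te touch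

      module Swap {g : Edge} (kg : K g) (¬tg : ¬ Touch S g) (g∉F : g ∉ F) (¬xy : ¬ Closes P g)
        {e : Edge} (e∈T : e ∈ T) (ke : K e) (touch-e : Touch (_≡ w) e) (¬T−e : ¬ Closes (T[ K ] − e) g) where

        x y : Fin n
        x = src g
        y = tgt g

        e∉part : ∀ z → ¬ Part z e
        e∉part = touch∉part e∈T touch-e

        around : Joined (T[ K ] − e) x (src e) × Joined (T[ K ] − e) (tgt e) y ⊎
                 Joined (T[ K ] − e) x (tgt e) × Joined (T[ K ] − e) (src e) y
        around with joined-split (inv kg) e
        ... | inj₁ p = contradiction p ¬T−e
        ... | inj₂ q = q

        drop : ∀ {u v} → Joined (T[ K ] − e) u v → Joined T[ K ] u v
        drop = joined-⊆ proj₁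

        near-e : Joined T[ K ] w (src e)
        near-e = [ (λ q → subst (λ v → Joined T[ K ] v (src e)) q ε)
                 , (λ q → subst (λ v → Joined T[ K ] v (src e)) q (joined-sym (closes (e∈T , ke)))) ]′ (meets touch-e)

        near-x : Joined T[ K ] w x
        near-x = [ (λ { (p , _) → near-e ◅◅ joined-sym (drop p) })
                 , (λ { (p , _) → near-e ◅◅ closes (e∈T , ke) ◅◅ joined-sym (drop p) }) ]′ around

        near-y : Joined T[ K ] w y
        near-y = near-x ◅◅ inv kg

        -- Had the call at `x` ended in an obstruction, `x` would belong to it and hence to `S`, and
        -- `g` would touch `S`.
        ix : Improvement (Part x) x
        ix = improvement (res x) λ b → ¬tg (touching g∉F (inj₁ (inj₂ (x , near-x , b))))

        iy : Improvement (Part y) y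
        iy = improvement (res y) λ b → ¬tg (touching g∉F (inj₂ (inj₂ (y , near-y , b))))

        module X = Improvement ix
        module Y = Improvement iy

        -- Both improvements can be made at once: the parts of `x` and `y` are disjoint because `P`
        -- does not join `x` to `y`.
        Swapped : Pred Edge 0ℓ
        Swapped i = i ≢ e × (i ≡ g ⊎ (Part x i × i ∈ X.T' ⊎ (Part y i × i ∈ Y.T' ⊎
          (¬ Part x i × ¬ Part y i × i ∈ T))))

        swapped? : Decidable Swapped
        swapped? i = ¬? (i ≟ e) ×-dec ((i ≟ g) ⊎-dec ((part? x i ×-dec (i ∈? X.T')) ⊎-dec
          ((part? y i ×-dec (i ∈? Y.T')) ⊎-dec
          (¬? (part? x i) ×-dec (¬? (part? y i) ×-dec (i ∈? T))))))

        T* : EdgeSet G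
        T* = ⟪ swapped? ⟫

        keep : ∀ {i} → i ≢ e → (i ∈ T) → (Part x i → i ∈ X.T') → (Part y i → i ∈ Y.T') → Swapped i
        keep {i} ≢e t f h with part? x i | part? y i
        ... | yes p | _     = ≢e , inj₂ (inj₁ (p , f p))
        ... | no _  | yes q = ≢e , inj₂ (inj₂ (inj₁ (q , h q)))
        ... | no ¬p | no ¬q = ≢e , inj₂ (inj₂ (inj₂ (¬p , ¬q , t)))

        out : ∀ {i} → ¬ K i → Swapped i → i ∈ T
        out ¬k (_ , inj₁ refl)                             = contradiction kg ¬k
        out ¬k (_ , inj₂ (inj₁ ((k , _) , _)))             = contradiction k ¬k
        out ¬k (_ , inj₂ (inj₂ (inj₁ ((k , _) , _))))      = contradiction k ¬k
        out ¬k (_ , inj₂ (inj₂ (inj₂ (_ , _ , t))))        = t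

        g≢e : g ≢ e
        g≢e refl = ¬tg (touch-mono inj₁ touch-e)

        rejoin-old : ∀ {i} → (T[ K ] − e) i → Closes (λ j → Swapped j × K j) i
        rejoin-old {i} ((t , k) , ≢e) with part? x i | part? y i
        ... | yes p | _ = joined-⊆
          (λ { (t' , p') → ((λ { refl → e∉part x p' }) , inj₂ (inj₁ (p' , t'))) , proj₁ p' }) (X.rejoin t p)
        ... | no _  | yes p = joined-⊆
          (λ { (t' , p') → ((λ { refl → e∉part y p' }) , inj₂ (inj₂ (inj₁ (p' , t')))) , proj₁ p' }) (Y.rejoin t p)
        ... | no ¬p | no ¬q = closes ((≢e , inj₂ (inj₂ (inj₂ (¬p , ¬q , t)))) , k)

        rejoin-e : Closes (λ j → Swapped j × K j) e
        rejoin-e with around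
        ... | inj₁ (p , q) = joined-sym (joined-⋆ rejoin-old p) ◅◅ closes ((g≢e , inj₁ refl) , kg) ◅◅
          joined-sym (joined-⋆ rejoin-old q)
        ... | inj₂ (p , q) = joined-⋆ rejoin-old q ◅◅ joined-sym (closes ((g≢e , inj₁ refl) , kg)) ◅◅
          joined-⋆ rejoin-old p

        rejoin : ∀ {i} → i ∈ T → K i → Closes (λ j → Swapped j × K j) i
        rejoin {i} t k with i ≟ e
        ... | yes refl = rejoin-e
        ... | no ≢e    = rejoin-old ((t , k) , ≢e)

        -- At a fixed vertex only one of `X.T'`, `Y.T'` and `T` matters, chosen by the component of
        -- `P` containing it, and `g` is the only possible further edge. At the ends of `g`,
        -- strictness of the improvements leaves room for it.
        record Local (v : Fin n) : Set where
          field
            U    : EdgeSet G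
            e∈U  : e ∈ U
            at-v : ∀ {i} → Swapped i → Inc i v → i ≡ g ⊎ i ∈ U
            U≤H  : degree U v ≤ H v
            room : Inc g v → degree U v < H v

        local : ∀ v → Local v
        local v with joined? P? x v | joined? P? y v
        ... | yes p | _ = record
          { U = X.T' ; e∈U = X.T⇒out (e∉part x) e∈T ; at-v = at-v ; U≤H = X.bounded v ; room = room }
          where
          at-v : ∀ {i} → Swapped i → Inc i v → i ≡ g ⊎ i ∈ X.T'
          at-v (_ , inj₁ eq) _ = inj₁ eq
          at-v (_ , inj₂ (inj₁ (_ , t))) _ = inj₂ t
          at-v (_ , inj₂ (inj₂ (inj₁ (q , _)))) i∋v = ⊥-elim (¬xy (p ◅◅ joined-sym (part-joined q i∋v)))
          at-v (_ , inj₂ (inj₂ (inj₂ (¬q , _ , t)))) _ = inj₂ (X.T⇒out ¬q t)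
          room : Inc g v → degree X.T' v < H v
          room (inj₁ refl) = X.strict
          room (inj₂ refl) = contradiction p ¬xy
        ... | no ¬q | yes p = record
          { U = Y.T' ; e∈U = Y.T⇒out (e∉part y) e∈T ; at-v = at-v ; U≤H = Y.bounded v ; room = room }
          where
          at-v : ∀ {i} → Swapped i → Inc i v → i ≡ g ⊎ i ∈ Y.T'
          at-v (_ , inj₁ eq) _ = inj₁ eq
          at-v (_ , inj₂ (inj₁ (q , _))) i∋v = ⊥-elim (¬q (part-joined q i∋v))
          at-v (_ , inj₂ (inj₂ (inj₁ (_ , t)))) _ = inj₂ t
          at-v (_ , inj₂ (inj₂ (inj₂ (_ , ¬q , t)))) _ = inj₂ (Y.T⇒out ¬q t)
          room : Inc g v → degree Y.T' v < H v
          room (inj₁ refl) = contradiction ε ¬q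
          room (inj₂ refl) = Y.strict
        ... | no ¬p | no ¬q = record
          { U = T ; e∈U = e∈T ; at-v = at-v ; U≤H = T≤H v ; room = room }
          where
          at-v : ∀ {i} → Swapped i → Inc i v → i ≡ g ⊎ i ∈ T
          at-v (_ , inj₁ eq) _ = inj₁ eq
          at-v (_ , inj₂ (inj₁ (p , _))) i∋v = ⊥-elim (¬p (part-joined p i∋v))
          at-v (_ , inj₂ (inj₂ (inj₁ (q , _)))) i∋v = ⊥-elim (¬q (part-joined q i∋v))
          at-v (_ , inj₂ (inj₂ (inj₂ (_ , _ , t)))) _ = inj₂ t
          room : Inc g v → degree T v < H v
          room (inj₁ refl) = contradiction ε ¬p
          room (inj₂ refl) = contradiction ε ¬q

        at? : ∀ (U : EdgeSet G) v → Decidable (λ i → i ∈ U × Inc i v)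
        at? U v i = (i ∈? U) ×-dec inc? i v

        bounded : ∀ v → degree T* v ≤ H v
        bounded v with inc? g v
        ... | no g∌v = ≤-trans (count-mono {P? = at? T* v} {Q? = at? U v} f) U≤H
          where
          open Local (local v)
          f : ∀ {i} → i ∈ T* × Inc i v → i ∈ U × Inc i v
          f (s , i∋v) with at-v (∈⟪⟫⁻ {P? = swapped?} s) i∋v
          ... | inj₁ refl = contradiction i∋v g∌v
          ... | inj₂ u    = u , i∋v
        ... | yes g∋v = begin
          degree T* v                ≤⟨ count-cover {P? = _≟ g} {Q? = at? U v} {R? = at? T* v} f ⟩
          count (_≟ g) + degree U v  ≡⟨ cong (_+ degree U v) (count-≡ g) ⟩
          suc (degree U v)           ≤⟨ room g∋v ⟩
          H v                        ∎
          where
          open Local (local v)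
          open ≤-Reasoning
          f : ∀ {i} → i ∈ T* × Inc i v → i ≡ g ⊎ (i ∈ U × Inc i v)
          f (s , i∋v) with at-v (∈⟪⟫⁻ {P? = swapped?} s) i∋v
          ... | inj₁ eq = inj₁ eq
          ... | inj₂ u  = inj₂ (u , i∋v)

        strict : degree T* w < H w
        strict = ≤-trans
          (count-mono-< {P? = at? T* w} {Q? = at? U w} f e
            (λ { (s , _) → proj₁ (∈⟪⟫⁻ {P? = swapped?} s) refl }) (e∈U , meets touch-e)) U≤H
          where
          open Local (local w)
          f : ∀ {i} → i ∈ T* × Inc i w → i ∈ U × Inc i w
          f (s , i∋w) with at-v (∈⟪⟫⁻ {P? = swapped?} s) i∋w
          -- Since `w` is in `S`, the edge `g` does not end at `w`, so the loss of `e` there is not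
          -- made up.
          ... | inj₁ refl = ⊥-elim (¬tg (touch-at g∉F (inj₁ refl) i∋w))
          ... | inj₂ u    = u , i∋w

        swap : Improvement K w
        swap = record
          { T' = T*
          ; F⊆T' = λ f → ∈⟪⟫⁺ {P? = swapped?}
              (keep (λ { refl → i∉F touch-e f }) (F⊆T f) (λ _ → X.F⊆T' f) (λ _ → Y.F⊆T' f))
          ; out⇒T = λ ¬k s → out ¬k (∈⟪⟫⁻ {P? = swapped?} s)
          ; T⇒out = λ ¬k t → ∈⟪⟫⁺ {P? = swapped?}
              (keep (λ { refl → ¬k ke }) t (λ p → contradiction (proj₁ p) ¬k) (λ p → contradiction (proj₁ p) ¬k))
          ; rejoin = λ t k → joined-⊆ (λ { (s , k') → ∈⟪⟫⁺ {P? = swapped?} s , k' }) (rejoin t k)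
          ; bounded = bounded
          ; strict = strict }

      combine : Outcome K w
      combine with any? (λ g → K? g ×-dec (¬? (touch? S? g) ×-dec
        (¬? (g ∈? F) ×-dec ¬? (joined? P? (src g) (tgt g)))))
      ... | yes (g , kg , ¬tg , g∉F , ¬p)
        -- Deleting all tree edges at `w` separates the ends of `g`; as these edges are bridges, a
        -- single one of them already does, and it is traded for `g`.
        with separating-edge TK? (touch? (_≟ w))
          (λ { (t , _) _ c → bridge t (joined-⊆ (λ { ((tj , _) , ≢e) → tj , ≢e }) c) }) (inv kg) ¬p
      ... | e , (t , k) , touch-e , ¬T−e = inj₁ (Swap.swap kg ¬tg g∉F ¬p t k touch-e ¬T−e)
      combine | no none = inj₂ (obstruction λ {g} kg ¬tg g∉F →
        decidable-stable (joined? P? (src g) (tgt g)) λ ¬p → none (g , kg , ¬tg , g∉F , ¬p))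

  -- `fuel` exceeds the number of tree edges in `K`. The invariant, that the tree edges in `K`
  -- already close every edge of `K`, passes to each part.
  reduce : ∀ fuel {K} (K? : Decidable K) → (∀ {g} → K g → Closes T[ K ] g) →
    count (λ i → (i ∈? T) ×-dec K? i) < fuel → ∀ w → Outcome K w
  reduce (suc fuel) {K} K? inv lt w with degree T w <? H w
  ... | yes room = inj₁ (unchanged room)
  ... | no ¬room with any? (λ e → (e ∈? T) ×-dec (K? e ×-dec touch? (_≟ w) e))
  -- At `w` there is nothing in `K` to delete, so `w` alone forms the obstruction.
  ... | no none = inj₂ (singleton-obstruction inv (≤-antisym (T≤H w) (≮⇒≥ ¬room)) none)
  ... | yes (e , t , k , touch) = Combine.combine λ x → reduce fuel (part? x) (part-inv x)
      (≤-trans (count-mono-< {P? = λ i → (i ∈? T) ×-dec part? x i} {Q? = TK?}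
        (λ { (t' , k' , _) → t' , k' }) e (λ { (_ , p) → touch∉part t touch x p }) (t , k)) (≤-pred lt)) x
    where
    open Step K? inv w (≤-antisym (T≤H w) (≮⇒≥ ¬room))
    TK? : Decidable T[ K ]
    TK? i = (i ∈? T) ×-dec K? i

-- Descent to a tree meeting the prescribed degrees

module Descent {n : ℕ} (G : Graph n) (F : EdgeSet G)
  (forest : ∀ {i} → i ∈ F → ¬ Joining.Closes G (λ j → j ∈ F × j ≢ i) i) where

  open Joining G
  open Touching G F

  record Spanning (U : EdgeSet G) : Set where
    field
      F⊆U       : F ⊆ U
      connected : ∀ u v → Joined (_∈ U) u v

  record Tree (T : EdgeSet G) : Set where
    field
      F⊆T       : F ⊆ T
      connected : ∀ u v → Joined (_∈ T) u v
      bridge    : ∀ {e} → e ∈ T → ¬ Closes ((_∈ T) − e) e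

  -- Edges outside `F` that lie on cycles are deleted one by one, which keeps connectivity and
  -- raises no degree.
  prune : ∀ fuel U → count (_∈? U) < fuel → Spanning U →
    ∃ λ T → Tree T × (∀ v → degree T v ≤ degree U v)
  prune (suc fuel) U lt sp
    with any? (λ j → (j ∈? U) ×-dec (¬? (j ∈? F) ×-dec
           joined? (λ i → (i ∈? U) ×-dec ¬? (i ≟ j)) (src j) (tgt j)))
  ... | no none = U , record { F⊆T = F⊆U ; connected = connected ; bridge = bridge } , λ _ → ≤-refl
    where
    open Spanning sp
    bridge-out : ∀ {e} → e ∈ U → e ∉ F → ¬ Closes ((_∈ U) − e) e
    bridge-out u ∉F c = none (_ , u , ∉F , c)
    bridge : ∀ {e} → e ∈ U → ¬ Closes ((_∈ U) − e) e
    bridge {e} u c with e ∈? F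
    ... | no e∉F  = bridge-out u e∉F c
    -- All edges outside `F` are bridges of `U` by now, so a walk closing `e` can be freed of them
    -- and would complete a cycle in `F`.
    ... | yes e∈F = forest e∈F (joined-⊆ (λ { {i} ((_ , ≢e) , ¬∉F) → decidable-stable (i ∈? F) ¬∉F , ≢e })
      (joined-avoid proj₁ (λ i → (i ∈? U) ×-dec ¬? (i ≟ e)) (λ i → ¬? (i ∈? F)) bridge-out c
        λ u' ∉F → closes (u , λ { refl → ∉F e∈F })))
  ... | yes (j , u , ∉F , c) with prune fuel ⟪ less? ⟫ lt' record
        { F⊆U = λ f → ∈⟪⟫⁺ {P? = less?} (F⊆U f , λ { refl → ∉F f })
        ; connected = λ x y → joined-⋆ (λ {i} → detour i) (connected x y) }
    where
    open Spanning sp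
    less? : Decidable ((_∈ U) − j)
    less? i = (i ∈? U) ×-dec ¬? (i ≟ j)
    lt' : count (_∈? ⟪ less? ⟫) < fuel
    lt' = ≤-trans (count-mono-< {P? = _∈? ⟪ less? ⟫} {Q? = _∈? U}
      (λ i∈ → proj₁ (∈⟪⟫⁻ {P? = less?} i∈)) j (λ j∈ → proj₂ (∈⟪⟫⁻ {P? = less?} j∈) refl) u) (≤-pred lt)
    detour : ∀ i → i ∈ U → Closes (_∈ ⟪ less? ⟫) i
    detour i u' with i ≟ j
    ... | yes refl = joined-⊆ (∈⟪⟫⁺ {P? = less?}) c
    ... | no ≢j    = closes (∈⟪⟫⁺ {P? = less?} (u' , ≢j))
  ... | T , tree , le = T , tree , λ v → ≤-trans (le v)
    (count-mono {P? = λ i → (i ∈? ⟪ less? ⟫) ×-dec inc? i v} {Q? = λ i → (i ∈? U) ×-dec inc? i v}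
      λ { (i∈ , i∋v) → proj₁ (∈⟪⟫⁻ {P? = less?} i∈) , i∋v })
    where
    less? : Decidable ((_∈ U) − j)
    less? i = (i ∈? U) ×-dec ¬? (i ≟ j)

  record Barrier (T : EdgeSet G) (h : Fin n → ℕ) : Set where
    field
      S      : Subset n
      w      : Fin n
      w∈S    : w ∈ S
      above  : ∀ {v} → v ∈ S → h v ≤ degree T v
      strict : h w < degree T w
      closed : ∀ {g} → ¬ Touch (_∈ S) g → Closes (λ i → i ∈ T × ¬ Touch (_∈ S) i) g

  module _ (h : Fin n → ℕ) where

    -- Induction on the total excess of the degrees over `h`; each improvement at a vertex above its
    -- target lowers it, and pruning does not raise it.
    descend : ∀ fuel T → Tree T → ∑ (λ v → degree T v ∸ h v) < fuel →
      (∃ λ T → Tree T × (∀ v → degree T v ≤ h v)) ⊎ (∃ λ T → Tree T × Barrier T h)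
    descend (suc fuel) T tree lt with any? (λ v → h v <? degree T v)
    ... | no none = inj₁ (T , tree , λ v → ≮⇒≥ λ lt → none (v , lt))
    ... | yes (w , over) with Reduction.reduce G F T (Tree.F⊆T tree) (Tree.bridge tree)
          -- With these allowances a vertex below its target may grow up to it, and a vertex at or
          -- above its target may not grow.
          (λ v → degree T v ⊔ h v) (λ v → m≤m⊔n _ _)
          _ (λ _ → yes tt) (λ _ → joined-⊆ (λ t → t , tt) (Tree.connected tree _ _)) ≤-refl w
    ... | inj₂ o = inj₂ (T , tree , record
      { S = S ; w = w ; w∈S = w∈S
      ; above = λ v∈ → ≤-trans (m≤n⊔m _ _) (≤-reflexive (sym (tight v∈)))
      ; strict = over
      ; closed = λ ¬tg → joined-avoid id (_∈? T) (touch? (_∈? S)) (λ t _ → Tree.bridge tree t)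
          (Tree.connected tree _ _) λ t te → blocked tt ¬tg t te })
      where open Reduction.Obstruction o
    ... | inj₁ a with prune _ (Reduction.Improvement.T' a) ≤-refl record
          { F⊆U = Reduction.Improvement.F⊆T' a
          ; connected = λ u v → joined-⊆ proj₁
              (joined-⋆ (λ t → Reduction.Improvement.rejoin a t tt) (Tree.connected tree u v)) }
    ... | T'' , tree'' , le = descend fuel T'' tree'' (≤-trans
      (∑-mono-< (λ v → ⊔-∸ {degree T'' v} {degree T v} (≤-trans (le v) (bounded v))) w
        (∸-strict (≤-trans (s≤s (le w)) (≤-trans strict (≤-reflexive (m≥n⇒m⊔n≡m (<⇒≤ over))))) over))
      (≤-pred lt))
      where open Reduction.Improvement a

  small-degrees : (∀ u v → Joined (λ _ → ⊤) u v) → (h : Fin n → ℕ) →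
    (∀ {T} → Tree T → ¬ Barrier T h) → ∃ λ T → Tree T × (∀ v → degree T v ≤ h v)
  small-degrees conn h no-barrier
    with prune _ full ≤-refl record { F⊆U = λ _ → ∈⊤ ; connected = λ u v → joined-⊆ (λ _ → ∈⊤) (conn u v) }
  ... | T , tree , _ with descend h _ T tree ≤-refl
  ... | inj₁ found           = found
  ... | inj₂ (_ , tree' , b) = contradiction b (no-barrier tree')

-- Counting across a closed set of vertices

count-at : ∀ {l} {S : Pred (Fin l) 0ℓ} (S? : Decidable S) a → count (λ v → S? v ×-dec (a ≟ v)) ≡ ind (S? a)
count-at {S = S} S? a with S? a
... | yes s = trans (count-cong {P? = λ v → S? v ×-dec (a ≟ v)} {Q? = _≟ a}
  (λ { (_ , refl) → refl }) λ { refl → s , refl }) (count-≡ a)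
... | no ¬s = ∑-zero _ λ v → ind-no (S? v ×-dec (a ≟ v)) λ { (s , refl) → ¬s s }

module Sums {n : ℕ} (S : Subset n) where

  Σˢ : (Fin n → ℕ) → ℕ
  Σˢ f = ∑ λ v → ind (v ∈? S) * f v

  Σˢ-mono : ∀ {f g} → (∀ {v} → v ∈ S → f v ≤ g v) → Σˢ f ≤ Σˢ g
  Σˢ-mono {f} {g} h = ∑-mono at
    where
    at : ∀ v → ind (v ∈? S) * f v ≤ ind (v ∈? S) * g v
    at v with v ∈? S
    ... | yes s = *-monoʳ-≤ 1 (h s)
    ... | no _  = z≤n

  Σˢ-mono-< : ∀ {f g} → (∀ {v} → v ∈ S → f v ≤ g v) → ∀ {w} → w ∈ S → f w < g w → Σˢ f < Σˢ g
  Σˢ-mono-< {f} {g} h {w} w∈ lt = ∑-mono-< at w strict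
    where
    at : ∀ v → ind (v ∈? S) * f v ≤ ind (v ∈? S) * g v
    at v with v ∈? S
    ... | yes s = *-monoʳ-≤ 1 (h s)
    ... | no _  = z≤n
    strict : ind (w ∈? S) * f w < ind (w ∈? S) * g w
    strict rewrite ind-yes (w ∈? S) w∈ = *-monoʳ-< 1 lt

  Σˢ-+ : ∀ f g → Σˢ (λ v → f v + g v) ≡ Σˢ f + Σˢ g
  Σˢ-+ f g = trans (sum-cong-≗ {n} λ v → *-distribˡ-+ (ind (v ∈? S)) (f v) (g v))
    (∑-distrib-+ (λ v → ind (v ∈? S) * f v) (λ v → ind (v ∈? S) * g v))

  Σˢ-* : ∀ k f → Σˢ (λ v → k * f v) ≡ k * Σˢ f
  Σˢ-* k f = trans (sum-cong-≗ {n} λ v → trans (sym (*-assoc i[ v ] k (f v)))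
    (trans (cong (_* f v) (*-comm i[ v ] k)) (*-assoc k i[ v ] (f v)))) (sym (*-∑ k (λ v → ind (v ∈? S) * f v)))
    where
    i[_] : Fin n → ℕ
    i[ v ] = ind (v ∈? S)

  Σˢ-const : ∀ c → Σˢ (λ _ → c) ≡ c * count (_∈? S)
  Σˢ-const c = trans (sum-cong-≗ {n} λ v → *-comm (ind (v ∈? S)) c)
    (sym (*-∑ c (λ v → ind (v ∈? S))))

module Handshake {n : ℕ} (G : Graph n) (S : Subset n) where

  open Joining G
  open Sums S

  private
    loop-free : ∀ i → src i ≢ tgt i
    loop-free i = All.lookup (loopless G) (∈-lookup i)

  -- The two ends of an edge are distinct because there are no loops, so they are counted separately
  -- and inclusion-exclusion applies.
  ends : ∀ i → count (λ v → (v ∈? S) ×-dec inc? i v) ≡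
    ind ((src i ∈? S) ⊎-dec (tgt i ∈? S)) + ind ((src i ∈? S) ×-dec (tgt i ∈? S))
  ends i = trans (≤-antisym
      (count-cover {P? = at (src i)} {Q? = at (tgt i)} {R? = both} λ { (s , inj₁ e) → inj₁ (s , e) ; (s , inj₂ e) → inj₂ (s , e) })
      (count-pack {P? = at (src i)} {Q? = at (tgt i)} {R? = both} (λ (s , e) → s , inj₁ e) (λ (s , e) → s , inj₂ e)
        λ { (_ , refl) (_ , eq) → loop-free i (sym eq) }))
    (trans (cong₂ _+_ (count-at (_∈? S) (src i)) (count-at (_∈? S) (tgt i))) (ind-⊎-× (src i ∈? S) (tgt i ∈? S)))
    where
    at : ∀ a → Decidable (λ v → v ∈ S × a ≡ v)
    at a v = (v ∈? S) ×-dec (a ≟ v)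
    both : Decidable (λ v → v ∈ S × Inc i v)
    both v = (v ∈? S) ×-dec inc? i v

  module _ {Q : Pred Edge 0ℓ} (Q? : Decidable Q) where

    touching? : Decidable (λ i → Q i × (src i ∈ S ⊎ tgt i ∈ S))
    touching? i = Q? i ×-dec ((src i ∈? S) ⊎-dec (tgt i ∈? S))

    inside? : Decidable (λ i → Q i × (src i ∈ S × tgt i ∈ S))
    inside? i = Q? i ×-dec ((src i ∈? S) ×-dec (tgt i ∈? S))

    handshake : Σˢ (λ v → count (λ i → Q? i ×-dec inc? i v)) ≡ count touching? + count inside?
    handshake = begin
      ∑ (λ v → ind (v ∈? S) * ∑ (λ i → ind (Q? i ×-dec inc? i v)))
        ≡⟨ sum-cong-≗ {n} (λ v → *-∑ (ind (v ∈? S)) (λ i → ind (Q? i ×-dec inc? i v))) ⟩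
      ∑ (λ v → ∑ (λ i → ind (v ∈? S) * ind (Q? i ×-dec inc? i v)))
        ≡⟨ ∑-comm {n} (λ v i → ind (v ∈? S) * ind (Q? i ×-dec inc? i v)) ⟩
      ∑ (λ i → ∑ (λ v → ind (v ∈? S) * ind (Q? i ×-dec inc? i v)))
        ≡⟨ sum-cong-≗ {m G} per-edge ⟩
      ∑ (λ i → ind (touching? i) + ind (inside? i))
        ≡⟨ ∑-distrib-+ (λ i → ind (touching? i)) (λ i → ind (inside? i)) ⟩
      count touching? + count inside? ∎
      where
      open ≡-Reasoning
      per-edge : ∀ i → ∑ (λ v → ind (v ∈? S) * ind (Q? i ×-dec inc? i v)) ≡ ind (touching? i) + ind (inside? i)
      per-edge i = begin
        ∑ (λ v → ind (v ∈? S) * ind (Q? i ×-dec inc? i v))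
          ≡⟨ sum-cong-≗ {n} (λ v → rearrange (v ∈? S) (inc? i v) (Q? i)) ⟩
        ∑ (λ v → ind (Q? i) * ind ((v ∈? S) ×-dec inc? i v))
          ≡⟨ *-∑ (ind (Q? i)) (λ v → ind ((v ∈? S) ×-dec inc? i v)) ⟨
        ind (Q? i) * count (λ v → (v ∈? S) ×-dec inc? i v)
          ≡⟨ cong (ind (Q? i) *_) (ends i) ⟩
        ind (Q? i) * (ind a? + ind b?)
          ≡⟨ *-distribˡ-+ (ind (Q? i)) _ _ ⟩
        ind (Q? i) * ind a? + ind (Q? i) * ind b?
          ≡⟨ cong₂ _+_ (ind-× (Q? i) a?) (ind-× (Q? i) b?) ⟨
        ind (touching? i) + ind (inside? i) ∎
        where
        a? = (src i ∈? S) ⊎-dec (tgt i ∈? S)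
        b? = (src i ∈? S) ×-dec (tgt i ∈? S)
        rearrange : ∀ {A B C : Set} (a? : Dec A) (b? : Dec B) (c? : Dec C) →
          ind a? * ind (c? ×-dec b?) ≡ ind c? * ind (a? ×-dec b?)
        rearrange (yes _) b? (yes _) = refl
        rearrange (yes _) b? (no _)  = refl
        rearrange (no _)  b? (yes _) = refl
        rearrange (no _)  b? (no _)  = refl

-- Independence of tree edges

module Bridges {n : ℕ} (G : Graph n) (T : EdgeSet G)
  (bridge : ∀ {e} → e ∈ T → ¬ Joining.Closes G (λ i → i ∈ T × i ≢ e) e) where

  open Joining G

  -- `L` consists of tree edges other than those still to come, so a walk over `L` joining the ends
  -- of the next edge would contradict that this edge is a bridge.
  independent-edges : ∀ L is → AllPairs _≢_ is → All (_∈ T) is →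
    (∀ {u v} → (u , v) ∈ˡ L → ∃ λ j → j ∈ T × All (j ≢_) is × edge G j ≡ (u , v)) →
    Independent L (map (edge G) is)
  independent-edges L [] _ _ _ = tt
  independent-edges L (i ∷ is) (i∉ ∷ uniq) (t ∷ ts) from =
    (λ c → bridge t (conn-⋆ old c)) , independent-edges (edge G i ∷ L) is uniq ts from'
    where
    old : ∀ {u v} → (u , v) ∈ˡ L → Joined ((_∈ T) − i) u v
    old l with from l
    ... | j , tj , j≢i ∷ _ , refl = closes (tj , j≢i)
    from' : ∀ {u v} → (u , v) ∈ˡ edge G i ∷ L → ∃ λ j → j ∈ T × All (j ≢_) is × edge G j ≡ (u , v)
    from' (here eq) = i , t , i∉ , sym eq
    from' (there l) with from l
    ... | j , tj , _ ∷ j∉ , eq = j , tj , j∉ , eq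

  independent : ∀ {P Q : Pred Edge 0ℓ} (P? : Decidable P) (Q? : Decidable Q) →
    (∀ {i} → P i → i ∈ T) → (∀ {i} → Q i → i ∈ T) → (∀ {i} → P i → ¬ Q i) →
    Independent (edgeList P?) (edgeList Q?)
  independent {P} P? Q? P⊆T Q⊆T disj = independent-edges _ _
    (filter⁺ Q? (allFin⁺ _)) (All.tabulate λ i∈ → Q⊆T (in-Q i∈)) from
    where
    in-Q : ∀ {i} → i ∈ˡ filter Q? (allFin _) → _
    in-Q i∈ = proj₂ (∈-filter⁻ Q? {xs = allFin _} i∈)
    from : ∀ {u v} → (u , v) ∈ˡ edgeList P? →
      ∃ λ j → j ∈ T × All (j ≢_) (filter Q? (allFin _)) × edge G j ≡ (u , v)
    from l with ∈-map⁻ (edge G) l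
    ... | j , k , refl with proj₂ (∈-filter⁻ P? {xs = allFin _} k)
    ... | p = j , P⊆T p , All.tabulate (λ { i∈ refl → disj p (in-Q i∈) }) , refl

  length-edgeList : ∀ {P : Pred Edge 0ℓ} (P? : Decidable P) → length (edgeList P?) ≡ count P?
  length-edgeList P? = trans (length-map (edge G) (filter P? (allFin _))) (length-filter-allFin P?)

  -- Stars serve as spanning sets of known size to compare with in `steinitz`: `|S| − 1` rays from
  -- `w` join all of `S`.
  star : ∀ w (vs : List (Fin n)) → List (Fin n × Fin n)
  star w = map (w ,_)

  others : (S : Subset n) → Fin n → List (Fin n)
  others S w = filter (λ v → (v ∈? S) ×-dec ¬? (v ≟ w)) (allFin n)

  length-others : ∀ {S w} → w ∈ S → suc (length (others S w)) ≡ count (_∈? S)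
  length-others {S} {w} w∈ = begin
    suc (length (others S w)) ≡⟨ cong suc (length-filter-allFin rest?) ⟩
    suc (count rest?)         ≡⟨ cong (_+ count rest?) (count-≡ w) ⟨
    count (_≟ w) + count rest? ≡⟨ ≤-antisym
      (count-pack {P? = _≟ w} {Q? = rest?} {R? = _∈? S} (λ { refl → w∈ }) proj₁ λ { eq (_ , ≢) → ≢ eq })
      (count-cover {P? = _≟ w} {Q? = rest?} {R? = _∈? S} λ {v} s → case-≟ v s) ⟩
    count (_∈? S) ∎
    where
    open ≡-Reasoning
    rest? : Decidable (λ v → v ∈ S × v ≢ w)
    rest? v = (v ∈? S) ×-dec ¬? (v ≟ w)
    case-≟ : ∀ v → v ∈ S → v ≡ w ⊎ v ∈ S × v ≢ w
    case-≟ v s with v ≟ w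
    ... | yes eq = inj₁ eq
    ... | no ≢w  = inj₂ (s , ≢w)

  star-centre : ∀ {S w v L} {vs : List (Fin n)} → v ∈ S → Conn (star w (others S w ++ vs) ++ L) w v
  star-centre {S} {w} {v} {L} {vs} s with v ≟ w
  ... | yes refl = ε
  ... | no ≢w = conn-link (∈-++⁺ˡ (∈-map⁺ (w ,_) (∈-++⁺ˡ (∈-filter⁺ (λ v → (v ∈? S) ×-dec ¬? (v ≟ w)) (∈-allFin v) (s , ≢w)))))

  few-inside : ∀ {S w} → w ∈ S → ∀ {Q : Pred Edge 0ℓ} (Q? : Decidable Q) →
    (∀ {i} → Q i → i ∈ T × src i ∈ S × tgt i ∈ S) → count Q? < count (_∈? S)
  few-inside {S} {w} w∈ Q? f = begin-strict
    count Q?                   ≡⟨ length-edgeList Q? ⟨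
    length (edgeList Q?)       ≤⟨ steinitz [] (edgeList Q?) D ind-Q spans ⟩
    length D                   ≡⟨ trans (length-map (w ,_) (others S w ++ [])) (cong length (++-identityʳ (others S w))) ⟩
    length (others S w)        <⟨ n<1+n _ ⟩
    suc (length (others S w))  ≡⟨ length-others w∈ ⟩
    count (_∈? S)              ∎
    where
    open ≤-Reasoning
    D = star w (others S w ++ [])
    ind-Q : Independent [] (edgeList Q?)
    ind-Q = independent-edges [] _ (filter⁺ Q? (allFin⁺ _))
      (All.tabulate λ i∈ → proj₁ (f (proj₂ (∈-filter⁻ Q? {xs = allFin _} i∈)))) λ ()
    spans : ∀ {e} → e ∈ˡ edgeList Q? → Conn (D ++ []) (proj₁ e) (proj₂ e)
    spans e∈ with ∈-map⁻ (edge G) e∈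
    ... | i , k , refl with f (proj₂ (∈-filter⁻ Q? {xs = allFin _} k))
    ... | _ , s , t = ~-sym (star-centre s) ◅◅ star-centre t

-- Counting in the contraction

length-filter-map-filter : ∀ {I J : Set} {P : Pred J 0ℓ} {R : Pred I 0ℓ}
  (P? : Decidable P) (f : I → J) (R? : Decidable R) xs →
  length (filter P? (map f (filter R? xs))) ≤ length (filter (P? ∘ f) xs)
length-filter-map-filter P? f R? [] = z≤n
length-filter-map-filter P? f R? (x ∷ xs) with R? x
length-filter-map-filter P? f R? (x ∷ xs) | no _ with P? (f x)
... | yes _ = m≤n⇒m≤1+n (length-filter-map-filter P? f R? xs)
... | no _  = length-filter-map-filter P? f R? xs
length-filter-map-filter P? f R? (x ∷ xs) | yes _ with P? (f x)
... | yes _ = s≤s (length-filter-map-filter P? f R? xs)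
... | no _  = length-filter-map-filter P? f R? xs

count-lookup : ∀ {I : Set} {P : Pred I 0ℓ} (P? : Decidable P) xs →
  count (P? ∘ Data.List.lookup xs) ≡ length (filter P? xs)
count-lookup P? xs = trans (sym (length-filter-tabulate P? (Data.List.lookup xs)))
  (cong (length ∘ filter P?) (tabulate-lookup xs))

module _ {n : ℕ} {G : Graph n} {S : EdgeSet G} where

  open Joining G

  reach⇒joined : ∀ {u v} → Reach G S u v → Joined (_∈ S) u v
  reach⇒joined here             = ε
  reach⇒joined (fwd i i∈ refl p) = closes i∈ ◅◅ reach⇒joined p
  reach⇒joined (bwd i i∈ refl p) = joined-sym (closes i∈) ◅◅ reach⇒joined p

  joined⇒reach : ∀ {u v} → Joined (_∈ S) u v → Reach G S u v
  joined⇒reach ε                                        = here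
  joined⇒reach (SC.fwd (i , i∈ , refl , refl) ◅ p) = fwd i i∈ refl (joined⇒reach p)
  joined⇒reach (SC.bwd (i , i∈ , refl , refl) ◅ p) = bwd i i∈ refl (joined⇒reach p)

module Contraction {n c : ℕ} (G : Graph n) (F : EdgeSet G) (H : Graph c) (φ : Fin n → Fin c)
  (contraction : IsContraction G F φ H) where

  open Joining G
  module H = Joining H

  -- A section of `φ`, choosing one vertex in each component of `F`; it carries walks in the
  -- contraction back to `G`.
  σ : Fin c → Fin n
  σ x = proj₁ (proj₁ contraction x)

  φσ : ∀ x → φ (σ x) ≡ x
  φσ x = proj₂ (proj₁ contraction x) refl

  σφ-joined : ∀ u → Joined (_∈ F) (σ (φ u)) u
  σφ-joined u = reach⇒joined (Equivalence.to (proj₁ (proj₂ contraction) (σ (φ u)) u) (φσ (φ u)))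

  φφ : Fin n × Fin n → Fin c × Fin c
  φφ e = φ (proj₁ e) , φ (proj₂ e)

  between? : Decidable (λ (e : Fin n × Fin n) → φ (proj₁ e) ≢ φ (proj₂ e))
  between? e = ¬? (φ (proj₁ e) ≟ φ (proj₂ e))

  -- Only an inequality, because edges of `G` inside a component of `F` may satisfy the condition on
  -- the right and disappear on the left.
  count-contracted : {P : Pred (Fin c × Fin c) 0ℓ} (P? : Decidable P) →
    count (P? ∘ edge H) ≤ count (P? ∘ φφ ∘ edge G)
  count-contracted P? = begin
    count (P? ∘ edge H)                ≡⟨ count-lookup P? (edges H) ⟩
    length (filter P? (edges H))       ≡⟨ cong (length ∘ filter P?) (proj₂ (proj₂ contraction)) ⟩
    length (filter P? (map φφ (filter between? (edges G)))) ≤⟨ length-filter-map-filter P? φφ between? (edges G) ⟩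
    length (filter (P? ∘ φφ) (edges G)) ≡⟨ count-lookup (P? ∘ φφ) (edges G) ⟨
    count (P? ∘ φφ ∘ edge G)           ∎
    where open ≤-Reasoning

  lift : ∀ {P : Pred H.Edge 0ℓ} {R : Rel (Fin n) 0ℓ} →
    (∀ {i} → P i → EqClosure R (σ (H.src i)) (σ (H.tgt i))) →
    ∀ {x y} → H.Joined P x y → EqClosure R (σ x) (σ y)
  lift {R = R} f = Eq.gfold (Eq.isEquivalence R) σ λ { (i , p , refl , refl) → f p }

  lift-all : ∀ {W : Pred Edge 0ℓ} → (∀ {i} → i ∈ F → W i) →
    (∀ x y → Joined W (σ x) (σ y)) → ∀ u v → Joined W u v
  lift-all F⊆W f u v = joined-⊆ F⊆W (joined-sym (σφ-joined u)) ◅◅ f _ _ ◅◅ joined-⊆ F⊆W (σφ-joined v)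

  edge-above : ∀ i → ∃ λ e → φφ (edge G e) ≡ edge H i
  edge-above i with ∈-map⁻ φφ (subst (edge H i ∈ˡ_) (proj₂ (proj₂ contraction)) (∈-lookup {xs = edges H} i))
  ... | e , e∈ , eq with ∈-filter⁻ between? {xs = edges G} e∈
  ... | e∈G , _ = index e∈G , trans (cong φφ (sym (lookup-index e∈G))) (sym eq)

  connected-above : (∀ x y → H.Joined (λ _ → ⊤) x y) → ∀ u v → Joined (λ _ → ⊤) u v
  connected-above conn = lift-all _ λ x y → lift (λ {i} _ → link i) (conn x y)
    where
    link : ∀ i → Joined (λ _ → ⊤) (σ (H.src i)) (σ (H.tgt i))
    link i with edge-above i
    ... | e , eq = subst₂ (λ a b → Joined (λ _ → ⊤) (σ a) (σ b)) (cong proj₁ eq) (cong proj₂ eq)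
      (joined-⊆ _ (σφ-joined (src e)) ◅◅ closes {P = λ _ → ⊤} {i = e} tt ◅◅ joined-sym (joined-⊆ _ (σφ-joined (tgt e))))

-- The two lower bounds on the number of edges leaving a closed set

module ClosedSet {n : ℕ} (G : Graph n) (F T : EdgeSet G) (F⊆T : F ⊆ T)
  (bridge : ∀ {e} → e ∈ T → ¬ Joining.Closes G (λ i → i ∈ T × i ≢ e) e)
  (connected : ∀ u v → Joining.Joined G (_∈ T) u v)
  (S : Subset n) (w : Fin n) (w∈S : w ∈ S)
  (closed : ∀ {g} → ¬ Touching.Touch G F (_∈ S) g →
    Joining.Closes G (λ i → i ∈ T × ¬ Touching.Touch G F (_∈ S) i) g) where

  open Joining G
  open Touching G F
  open Sums S
  open Handshake G S
  open Bridges G T bridge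
  open import Data.List.Membership.DecPropositional (_≟_ {n}) using () renaming (_∈?_ to _∈ˡ?_)

  touchS? : Decidable (Touch (_∈ S))
  touchS? = touch? (_∈? S)

  W B : Pred Edge 0ℓ
  W i = i ∈ T × ¬ Touch (_∈ S) i
  B i = i ∈ T × Touch (_∈ S) i

  W? : Decidable W
  W? i = (i ∈? T) ×-dec ¬? (touchS? i)

  B? : Decidable B
  B? i = (i ∈? T) ×-dec touchS? i

  F⊆W : ∀ {i} → i ∈ F → W i
  F⊆W f = F⊆T f , λ t → i∉F t f

  B-independent : Independent (edgeList W?) (edgeList B?)
  B-independent = independent W? B? proj₁ proj₁ λ { (_ , ¬t) (_ , t) → ¬t t }

  -- The deleted tree edges are independent over the remaining ones, so reconnecting the components
  -- takes at least as many links.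
  B-bound : ∀ D → (∀ u v → Conn (D ++ edgeList W?) u v) → count B? ≤ length D
  B-bound D spans = subst (_≤ length D) (length-edgeList B?)
    (steinitz (edgeList W?) (edgeList B?) D B-independent λ _ → spans _ _)

  W⇒conn : ∀ D {u v} → Joined W u v → Conn (D ++ edgeList W?) u v
  W⇒conn D p = conn-⊆ (∈-++⁺ʳ D) (joined⇒conn W? p)

  inner : EdgeSet G → ℕ
  inner U = count (inside? (outside? U))

  inner-mono : inner T ≤ inner full
  inner-mono = count-mono {P? = inside? (outside? T)} {Q? = inside? (outside? full)}
    λ { ((_ , ∉F) , s) → (∈⊤ , ∉F) , s }

  inner-forest : suc (inner T) ≤ count (_∈? S)
  inner-forest = few-inside w∈S (inside? (outside? T)) λ { ((t , _) , s , s') → t , s , s' }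

  extra-T : Σˢ (extra T) ≡ count B? + inner T
  extra-T = trans (handshake (outside? T)) (cong (_+ inner T)
    (count-cong {P? = touching? (outside? T)} {Q? = B?}
      (λ { ((t , ∉F) , s) → t , touching ∉F s }) (λ { (t , touching ∉F s) → (t , ∉F) , s })))

  extra-full : Σˢ (extra full) ≡ count touchS? + inner full
  extra-full = trans (handshake (outside? full)) (cong (_+ inner full)
    (count-cong {P? = touching? (outside? full)} {Q? = touchS?}
      (λ { ((_ , ∉F) , s) → touching ∉F s }) (λ { (touching ∉F s) → (∈⊤ , ∉F) , s })))

  extra-mono : Σˢ (extra T) ≤ Σˢ (extra full)
  extra-mono = Σˢ-mono λ {v} _ → count-mono {P? = λ i → outside? T i ×-dec inc? i v}
    {Q? = λ i → outside? full i ×-dec inc? i v}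
    λ { ((_ , ∉F) , s) → (∈⊤ , ∉F) , s }

  module TreePacking {c : ℕ} (H : Graph c) (φ : Fin n → Fin c) (con : IsContraction G F φ H)
    (k : ℕ) (Ts : Fin k → EdgeSet H) (spanning : ∀ j x y → Joining.Joined H (_∈ Ts j) x y)
    (disjoint : ∀ j j' → j ≢ j' → ∀ e → e ∈ Ts j → e ∉ Ts j') where

    open Contraction G F H φ con

    Cross : Pred (Fin c × Fin c) 0ℓ
    Cross (a , b) = ¬ Joined W (σ a) (σ b)

    cross? : Decidable Cross
    cross? (a , b) = ¬? (joined? W? (σ a) (σ b))

    crossing? : ∀ j → Decidable (λ i → i ∈ Ts j × Cross (edge H i))
    crossing? j i = (i ∈? Ts j) ×-dec cross? (edge H i)

    crossing-edges : ∀ j → List (Fin n × Fin n)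
    crossing-edges j = map (λ i → σ (H.src i) , σ (H.tgt i)) (filter (crossing? j) (allFin _))

    -- The tree `Ts j` connects the contraction, and those of its edges that do not cross are
    -- already replaced by walks in `W`.
    spans : ∀ j u v → Conn (crossing-edges j ++ edgeList W?) u v
    spans j u v = W⇒conn D (joined-sym (joined-⊆ F⊆W (σφ-joined u))) ◅◅
      lift (λ {i} → link i) (spanning j (φ u) (φ v)) ◅◅ W⇒conn D (joined-⊆ F⊆W (σφ-joined v))
      where
      D = crossing-edges j
      link : ∀ i → i ∈ Ts j → Conn (D ++ edgeList W?) (σ (H.src i)) (σ (H.tgt i))
      link i t with joined? W? (σ (H.src i)) (σ (H.tgt i))
      ... | yes p = W⇒conn D p
      ... | no ¬p = conn-link (∈-++⁺ˡ (∈-map⁺ _ (∈-filter⁺ (crossing? j) (∈-allFin i) (t , ¬p))))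

    many-crossing : ∀ j → count B? ≤ count (crossing? j)
    many-crossing j = ≤-trans (B-bound _ (spans j)) (≤-reflexive
      (trans (length-map _ (filter (crossing? j) (allFin _))) (length-filter-allFin (crossing? j))))

    crossing-touches : ∀ {i} → Cross (φφ (edge G i)) → Touch (_∈ S) i
    crossing-touches {i} ¬p = decidable-stable (touchS? i) λ ¬t →
      ¬p (joined-⊆ F⊆W (σφ-joined _) ◅◅ closed ¬t ◅◅ joined-sym (joined-⊆ F⊆W (σφ-joined _)))

    -- Each of the `k` disjoint trees crosses between the components at least `count B?` times, and
    -- since `S` is closed every crossing comes from an edge touching `S`.
    B-packing : count B? * k ≤ count touchS?
    B-packing = begin
      count B? * k                    ≡⟨ cong (count B? *_) (length-tabulate id) ⟨
      count B? * length (allFin k)    ≤⟨ count-packing (count B?) crossing?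
        (AllPairs.map (λ j≢ {i} p q → disjoint _ _ j≢ i (proj₁ p) (proj₁ q)) (allFin⁺ k))
        (All.tabulate λ {j} _ → many-crossing j) (cross? ∘ edge H) (λ _ → proj₂) ⟩
      count (cross? ∘ edge H)         ≤⟨ count-contracted cross? ⟩
      count (cross? ∘ φφ ∘ edge G)    ≤⟨ count-mono {P? = cross? ∘ φφ ∘ edge G} {Q? = touchS?} crossing-touches ⟩
      count touchS?                   ∎
      where open ≤-Reasoning

  Fresh : Fin n → Set
  Fresh x = ∀ s → s ∈ S → ¬ Joined W x s

  Covered : List (Fin n) → Fin n → Set
  Covered xs v = ∃ λ x → (x ∈ S ⊎ x ∈ˡ xs) × Joined W x v

  -- Greedy choice of one vertex in each component of `W` that misses `S`; a vertex already reached
  -- from `S` or from an earlier choice is skipped.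
  representatives : ∀ vs → ∃ λ xs → AllPairs (λ x y → ¬ Joined W x y) xs × All Fresh xs ×
    (∀ {v} → v ∈ˡ vs → Covered xs v)
  representatives [] = [] , [] , [] , λ ()
  representatives (v ∷ vs) with representatives vs
  ... | xs , apart , fresh , cover with any? (λ x → ((x ∈? S) ⊎-dec (x ∈ˡ? xs)) ×-dec joined? W? x v)
  ... | yes found = xs , apart , fresh , λ { (here refl) → found ; (there i) → cover i }
  ... | no none = v ∷ xs
    , All.tabulate (λ {x} x∈ p → none (x , inj₂ x∈ , joined-sym p)) ∷ apart
    , (λ s s∈ p → none (s , inj₁ s∈ , joined-sym p)) ∷ fresh
    , λ { (here refl) → v , inj₂ (here refl) , ε
        ; (there i) → let x , x∈ , p = cover i in x , [ inj₁ , inj₂ ∘ there ]′ x∈ , p }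

  Separates : Fin n → Pred (Fin n × Fin n) 0ℓ
  Separates x (a , b) = Joined W x a × ¬ Joined W x b ⊎ ¬ Joined W x a × Joined W x b

  separates? : ∀ x → Decidable (Separates x)
  separates? x (a , b) = (joined? W? x a ×-dec ¬? (joined? W? x b)) ⊎-dec
    (¬? (joined? W? x a) ×-dec joined? W? x b)

  separates-touch : ∀ {x i} → Separates x (edge G i) → Touch (_∈ S) i
  separates-touch {x} {i} sep = decidable-stable (touchS? i) λ ¬t → cut sep (closed ¬t)
    where
    cut : Separates x (edge G i) → ¬ Closes W i
    cut (inj₁ (p , ¬q)) r = ¬q (p ◅◅ r)
    cut (inj₂ (¬p , q)) r = ¬p (q ◅◅ joined-sym r)

  Boundary : Pred Edge 0ℓ
  Boundary i = Touch (_∈ S) i × ¬ (src i ∈ S × tgt i ∈ S)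

  boundary? : Decidable Boundary
  boundary? i = touchS? i ×-dec ¬? ((src i ∈? S) ×-dec (tgt i ∈? S))

  separates-boundary : ∀ {x} → Fresh x → ∀ {i} → Separates x (edge G i) → Boundary i
  separates-boundary fresh sep = separates-touch sep , λ (s , t) →
    [ (λ (p , _) → fresh _ s p) , (λ (_ , q) → fresh _ t q) ]′ sep

  -- An edge leaving both components would run from one to the other; but one of its ends is in `S`,
  -- which both components miss.
  separates-disjoint : ∀ {x y} → Fresh x → Fresh y → ¬ Joined W x y →
    ∀ {i} → Separates x (edge G i) → ¬ Separates y (edge G i)
  separates-disjoint fx fy ¬xy sx sy with separates-touch sx | sx | sy
  ... | touching _ t | inj₁ (p , _) | inj₁ (q , _) = ¬xy (p ◅◅ joined-sym q)
  ... | touching _ t | inj₂ (_ , p) | inj₂ (_ , q) = ¬xy (p ◅◅ joined-sym q)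
  ... | touching _ t | inj₁ (p , _) | inj₂ (_ , q) = [ (λ s → fx _ s p) , (λ s → fy _ s q) ]′ t
  ... | touching _ t | inj₂ (_ , p) | inj₁ (q , _) = [ (λ s → fy _ s q) , (λ s → fx _ s p) ]′ t

  boundary-bound : count boundary? + inner full ≤ count touchS?
  boundary-bound = count-pack {P? = boundary?} {Q? = inside? (outside? full)} {R? = touchS?}
    proj₁ (λ { ((_ , ∉F) , s , _) → touching ∉F (inj₁ s) }) λ { (_ , ¬in) (_ , in-S) → ¬in in-S }

  -- A star from `w` to the rest of `S` and to the representatives reconnects everything, so
  -- `B-bound` applies to it.
  B-components : ∀ {xs} → (∀ v → Covered xs v) → suc (count B?) ≤ count (_∈? S) + length xs
  B-components {xs} cover = begin
    suc (count B?)                         ≤⟨ s≤s (B-bound D λ u v → ~-sym (centre u) ◅◅ centre v) ⟩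
    suc (length D)                         ≡⟨ cong suc (length-map (w ,_) (others S w ++ xs)) ⟩
    suc (length (others S w ++ xs))        ≡⟨ cong suc (length-++ (others S w)) ⟩
    suc (length (others S w)) + length xs  ≡⟨ cong (_+ length xs) (length-others w∈S) ⟩
    count (_∈? S) + length xs              ∎
    where
    open ≤-Reasoning
    D = star w (others S w ++ xs)
    centre : ∀ v → Conn (D ++ edgeList W?) w v
    centre v with cover v
    ... | x , inj₁ x∈ , p = star-centre x∈ ◅◅ W⇒conn D p
    ... | x , inj₂ x∈ , p = conn-link (∈-++⁺ˡ (∈-map⁺ (w ,_) (∈-++⁺ʳ (others S w) x∈))) ◅◅ W⇒conn D p

  module EdgeCut {c : ℕ} (H : Graph c) (φ : Fin n → Fin c) (con : IsContraction G F φ H)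
    (k : ℕ) (edge-connected : EdgeConnected k H) where

    open Contraction G F H φ con

    module _ {x : Fin n} (fresh : Fresh x) where

      σσ : Fin c × Fin c → Fin n × Fin n
      σσ (a , b) = σ a , σ b

      cut? : Decidable (λ i → Separates x (σσ (edge H i)))
      cut? i = separates? x (σσ (edge H i))

      uncut : ∀ {a b} → ¬ Separates x (a , b) → Joined W x a → Joined W x b
      uncut {a} {b} ¬sep p = decidable-stable (joined? W? x b) λ ¬q → ¬sep (inj₁ (p , ¬q))

      uncut′ : ∀ {a b} → ¬ Separates x (a , b) → Joined W x b → Joined W x a
      uncut′ {a} {b} ¬sep q = decidable-stable (joined? W? x a) λ ¬p → ¬sep (inj₂ (¬p , q))

      follow : ∀ {a b} → H.Joined (_∈ ∁ ⟪ cut? ⟫) a b → Joined W x (σ a) → Joined W x (σ b)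
      follow ε p = p
      follow (SC.fwd (i , i∈ , refl , refl) ◅ r) p =
        follow r (uncut (x∈∁p⇒x∉p i∈ ∘ ∈⟪⟫⁺ {P? = cut?}) p)
      follow (SC.bwd (i , i∈ , refl , refl) ◅ r) p =
        follow r (uncut′ (x∈∁p⇒x∉p i∈ ∘ ∈⟪⟫⁺ {P? = cut?}) p)

      W-σφ : ∀ u → Joined W (σ (φ u)) u
      W-σφ u = joined-⊆ F⊆W (σφ-joined u)

      cut-below : ∀ {i} → Separates x (σσ (φφ (edge G i))) → Separates x (edge G i)
      cut-below (inj₁ (p , ¬q)) = inj₁ (p ◅◅ W-σφ _ , λ q → ¬q (q ◅◅ joined-sym (W-σφ _)))
      cut-below (inj₂ (¬p , q)) = inj₂ ((λ p → ¬p (p ◅◅ joined-sym (W-σφ _))) , q ◅◅ W-σφ _)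

      -- Deleting fewer than `k` edges would leave a walk from `φ x` to `φ w` that never leaves the
      -- component of `x`, though `w` is in `S`.
      large-cut-above : k ≤ ∣ ⟪ cut? ⟫ ∣
      large-cut-above = ≮⇒≥ λ small → fresh w w∈S
        (follow (reach⇒joined (edge-connected ⟪ cut? ⟫ small (φ x) (φ w))) (joined-sym (W-σφ x)) ◅◅ W-σφ w)

      large-cut : k ≤ count (separates? x ∘ edge G)
      large-cut = begin
        k                                         ≤⟨ large-cut-above ⟩
        ∣ ⟪ cut? ⟫ ∣                              ≡⟨ ∣∣≡count ⟪ cut? ⟫ ⟩
        count (_∈? ⟪ cut? ⟫)                      ≤⟨ count-mono {P? = _∈? ⟪ cut? ⟫} {Q? = cut?} (∈⟪⟫⁻ {P? = cut?}) ⟩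
        count cut?                                ≤⟨ count-contracted (separates? x ∘ σσ) ⟩
        count (separates? x ∘ σσ ∘ φφ ∘ edge G)   ≤⟨ count-mono {P? = separates? x ∘ σσ ∘ φφ ∘ edge G}
          {Q? = separates? x ∘ edge G} cut-below ⟩
        count (separates? x ∘ edge G)             ∎
        where open ≤-Reasoning

    pairwise-disjoint : ∀ {xs} → All Fresh xs → AllPairs (λ x y → ¬ Joined W x y) xs →
      AllPairs (λ x y → ∀ {i} → Separates x (edge G i) → ¬ Separates y (edge G i)) xs
    pairwise-disjoint [] [] = []
    pairwise-disjoint (f ∷ fs) (a ∷ as) =
      All.zipWith (λ (fy , ¬xy) {i} → separates-disjoint f fy ¬xy {i}) (fs , a) ∷ pairwise-disjoint fs as

    components : ∃ λ q → suc (count B?) ≤ count (_∈? S) + q × k * q ≤ count boundary?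
    components with representatives (allFin n)
    ... | xs , apart , fresh , cover = length xs , B-components (λ v → cover (∈-allFin v)) ,
      count-packing k (λ x → separates? x ∘ edge G) (pairwise-disjoint fresh apart)
        (All.map (λ f → large-cut f) fresh) boundary?
        λ x∈ sep → separates-boundary (All.lookup fresh x∈) sep

-- Arithmetic

module _ where

  open ≤-Reasoning
  open NatSolver

  -- Here `eT` and `e` count the edges inside `S` of the tree and of `G`, outside `F`. One copy of
  -- `eT` is paid for by `e`, the other `k'` by the forest bound `suc eT ≤ s`.
  tree-arithmetic : ∀ k' {b eT τ e s} → b * suc k' ≤ τ → eT ≤ e → suc eT ≤ s →
    suc k' * (b + eT) + 1 * k' ≤ (τ + e) + 1 * k' * s
  tree-arithmetic k' {b} {eT} {τ} {e} {s} p q r = begin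
    suc k' * (b + eT) + 1 * k'
      ≡⟨ solve 3 (λ k b t → (con 1 :+ k) :* (b :+ t) :+ con 1 :* k := (b :* (con 1 :+ k) :+ t) :+ con 1 :* k :* (con 1 :+ t)) refl k' b eT ⟩
    (b * suc k' + eT) + 1 * k' * suc eT ≤⟨ +-mono-≤ (+-mono-≤ p q) (*-monoʳ-≤ (1 * k') r) ⟩
    (τ + e) + 1 * k' * s                ∎

  -- Edges inside `S` are separate from the boundary and count twice in the degree sum, once within
  -- `τ` and once as `e`, so they pay for two copies of `eT`; the forest bound pays for the other
  -- `k`.
  edge-arithmetic : ∀ k {b eT q d τ e s} → suc b ≤ s + q → suc (suc k) * q ≤ d → d + e ≤ τ →
    eT ≤ e → suc eT ≤ s → suc (suc k) * (b + eT) + 2 * suc k ≤ (τ + e) + 2 * suc k * s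
  edge-arithmetic k {b} {eT} {q} {d} {τ} {e} {s} p₁ p₂ p₃ p₄ p₅ = begin
    suc (suc k) * (b + eT) + 2 * suc k
      ≡⟨ solve 3 (λ k b t → (con 2 :+ k) :* (b :+ t) :+ con 2 :* (con 1 :+ k) :=
           (con 2 :+ k) :* (con 1 :+ b) :+ (t :+ t) :+ k :* (con 1 :+ t)) refl k b eT ⟩
    suc (suc k) * suc b + (eT + eT) + k * suc eT
      ≤⟨ +-mono-≤ (+-mono-≤ (*-monoʳ-≤ (suc (suc k)) p₁) (+-mono-≤ p₄ p₄)) (*-monoʳ-≤ k p₅) ⟩
    suc (suc k) * (s + q) + (e + e) + k * s
      ≡⟨ solve 4 (λ k s q e → (con 2 :+ k) :* (s :+ q) :+ (e :+ e) :+ k :* s :=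
           ((con 2 :+ k) :* q :+ e :+ e) :+ con 2 :* (con 1 :+ k) :* s) refl k s q e ⟩
    (suc (suc k) * q + e + e) + 2 * suc k * s
      ≤⟨ +-monoˡ-≤ (2 * suc k * s) (+-monoˡ-≤ e (≤-trans (+-monoˡ-≤ e p₂) p₃)) ⟩
    (τ + e) + 2 * suc k * s ∎

  ceiling-bound : ∀ a k' → a ≤ suc k' * ((a + k') / suc k')
  ceiling-bound a k' = +-cancelʳ-≤ k' a _ (begin
    a + k'                                    ≡⟨ m≡m%n+[m/n]*n (a + k') (suc k') ⟩
    (a + k') % suc k' + q * suc k'            ≤⟨ +-monoˡ-≤ (q * suc k') (≤-pred (m%n<n (a + k') (suc k'))) ⟩
    k' + q * suc k'                           ≡⟨ +-comm k' _ ⟩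
    q * suc k' + k'                           ≡⟨ cong (_+ k') (*-comm q (suc k')) ⟩
    suc k' * q + k'                           ∎)
    where q = (a + k') / suc k'

  floor-bound : ∀ a k' → suc a ≤ suc k' * (a / suc k') + suc k'
  floor-bound a k' = begin-strict
    a                                ≡⟨ m≡m%n+[m/n]*n a (suc k') ⟩
    a % suc k' + a / suc k' * suc k' <⟨ +-monoˡ-< (a / suc k' * suc k') (m%n<n a (suc k')) ⟩
    suc k' + a / suc k' * suc k'     ≡⟨ trans (+-comm (suc k') _) (cong (_+ suc k') (*-comm (a / suc k') (suc k'))) ⟩
    suc k' * (a / suc k') + suc k'   ∎

module _ where

  open ℤₚ.≤-Reasoning
  open IntSolver

  -- With k = k' + 1, the bound ⌈(d − j)/k⌉ + j equals ⌊(d + j k' + k')/k⌋.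
  ceiling-ℤ : ∀ j d k' t f → t ≤ (d + j * k' + k') / suc k' →
    ℤ.+ (f + t) ℤ.≤ ⌈ ℤ.+ (f + d) ℤ.- ℤ.+ f ℤ.- ℤ.+ j / suc k' ⌉ ℤ.+ ℤ.+ f ℤ.+ ℤ.+ j
  ceiling-ℤ j d k' t f le = begin
    ℤ.+ (f + t)              ≡⟨ ℤₚ.pos-+ f t ⟩
    F ℤ.+ T                  ≡⟨ solve 3 (λ f t q → f :+ t := (t :+ q) :+ (:- q :+ f)) refl F T q ⟩
    (T ℤ.+ q) ℤ.+ (ℤ.- q ℤ.+ F) ≤⟨ ℤₚ.+-monoˡ-≤ (ℤ.- q ℤ.+ F) T+q≤J ⟩
    J ℤ.+ (ℤ.- q ℤ.+ F)      ≡⟨ ℤₚ.+-comm J (ℤ.- q ℤ.+ F) ⟩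
    ℤ.- q ℤ.+ F ℤ.+ J        ∎
    where
    F = ℤ.+ f
    T = ℤ.+ t
    D = ℤ.+ d
    J = ℤ.+ j
    K' = ℤ.+ k'
    K = ℤ.+ suc k'
    X = ℤ.+ (f + d) ℤ.- F ℤ.- J
    q = (ℤ.- X) ℤ./ℕ suc k'

    tK : t * suc k' ≤ d + j * k' + k'
    tK = ≤-trans (*-monoˡ-≤ (suc k') le) (m/n*n≤m (d + j * k' + k') (suc k'))

    tKℤ : T ℤ.* K ℤ.≤ D ℤ.+ J ℤ.* K' ℤ.+ K'
    tKℤ = begin
      T ℤ.* K                    ≡⟨ ℤₚ.pos-* t (suc k') ⟨
      ℤ.+ (t * suc k')           ≤⟨ ℤ.+≤+ tK ⟩
      ℤ.+ (d + j * k' + k')      ≡⟨ ℤₚ.pos-+ (d + j * k') k' ⟩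
      ℤ.+ (d + j * k') ℤ.+ K'    ≡⟨ cong (ℤ._+ K') (ℤₚ.pos-+ d (j * k')) ⟩
      D ℤ.+ ℤ.+ (j * k') ℤ.+ K'  ≡⟨ cong (λ x → D ℤ.+ x ℤ.+ K') (ℤₚ.pos-* j k') ⟩
      D ℤ.+ J ℤ.* K' ℤ.+ K'      ∎

    scaled : (T ℤ.+ q) ℤ.* K ℤ.< (ℤ.+ 1 ℤ.+ J) ℤ.* K
    scaled = begin-strict
      (T ℤ.+ q) ℤ.* K          ≡⟨ ℤₚ.*-distribʳ-+ K T q ⟩
      T ℤ.* K ℤ.+ q ℤ.* K      ≤⟨ ℤₚ.+-mono-≤ tKℤ ([n/ℕd]*d≤n (ℤ.- X) (suc k')) ⟩
      D ℤ.+ J ℤ.* K' ℤ.+ K' ℤ.+ (ℤ.- X)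
        ≡⟨ cong (λ x → D ℤ.+ J ℤ.* K' ℤ.+ K' ℤ.+ (ℤ.- (x ℤ.- F ℤ.- J))) (ℤₚ.pos-+ f d) ⟩
      D ℤ.+ J ℤ.* K' ℤ.+ K' ℤ.+ (ℤ.- (F ℤ.+ D ℤ.- F ℤ.- J))
        ≡⟨ solve 4 (λ d j k f → d :+ j :* k :+ k :+ (:- (f :+ d :- f :- j)) :=
             j :* (con (ℤ.+ 1) :+ k) :+ k) refl D J K' F ⟩
      J ℤ.* (ℤ.+ 1 ℤ.+ K') ℤ.+ K'
        <⟨ ℤₚ.+-monoʳ-< (J ℤ.* (ℤ.+ 1 ℤ.+ K')) (ℤ.+<+ (n<1+n k')) ⟩
      J ℤ.* (ℤ.+ 1 ℤ.+ K') ℤ.+ (ℤ.+ 1 ℤ.+ K')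
        ≡⟨ solve 2 (λ j k → j :* (con (ℤ.+ 1) :+ k) :+ (con (ℤ.+ 1) :+ k) :=
             (con (ℤ.+ 1) :+ j) :* (con (ℤ.+ 1) :+ k)) refl J K' ⟩
      (ℤ.+ 1 ℤ.+ J) ℤ.* (ℤ.+ 1 ℤ.+ K') ∎

    -- The ceiling is `- q`. By `scaled`, the integer `T + q` is less than `J + 1`, hence at most
    -- `J`.
    T+q≤J : T ℤ.+ q ℤ.≤ J
    T+q≤J = ℤₚ.≮⇒≥ λ lt → ℤₚ.<⇒≱ (ℤₚ.*-cancelʳ-<-nonNeg K scaled) (ℤₚ.i<j⇒suc[i]≤j lt)

  floor-ℤ : ∀ d k' t f → t ≤ d / suc k' →
    ℤ.+ (f + t) ℤ.≤ ⌊ ℤ.+ (f + d) ℤ.- ℤ.+ f / suc k' ⌋ ℤ.+ ℤ.+ f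
  floor-ℤ d k' t f le = begin
    ℤ.+ (f + t)                       ≡⟨ trans (cong ℤ.+_ (+-comm f t)) (ℤₚ.pos-+ t f) ⟩
    ℤ.+ t ℤ.+ ℤ.+ f                   ≤⟨ ℤₚ.+-monoˡ-≤ (ℤ.+ f) (ℤ.+≤+ le) ⟩
    ℤ.+ (d / suc k') ℤ.+ ℤ.+ f        ≡⟨ cong (λ x → x ℤ./ℕ suc k' ℤ.+ ℤ.+ f) (sym d-eq) ⟩
    ⌊ ℤ.+ (f + d) ℤ.- ℤ.+ f / suc k' ⌋ ℤ.+ ℤ.+ f ∎
    where
    d-eq : ℤ.+ (f + d) ℤ.- ℤ.+ f ≡ ℤ.+ d
    d-eq = trans (cong (ℤ._- ℤ.+ f) (ℤₚ.pos-+ f d))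
      (solve 2 (λ f d → f :+ d :- f := d) refl (ℤ.+ f) (ℤ.+ d))

-- Assembling the theorem

module Assembly {n : ℕ} (G : Graph n) (F : EdgeSet G)
  (forest : ∀ {i} → i ∈ F → ¬ Joining.Closes G (λ j → j ∈ F × j ≢ i) i)
  (connected : ∀ u v → Joining.Joined G (λ _ → ⊤) u v) (k' c : ℕ) where

  open Joining G
  open Touching G F
  open Descent G F forest
  open Sums

  d : Fin n → ℕ
  d = extra full

  Budget : Set
  Budget = ∀ {T} → Tree T → ∀ S {w} → w ∈ S →
    (∀ {g} → ¬ Touch (_∈ S) g → Closes (λ i → i ∈ T × ¬ Touch (_∈ S) i) g) →
    suc k' * Σˢ S (extra T) + c ≤ Σˢ S d + c * count (_∈? S)

  -- Exactly what contradicts `Budget` at a barrier: there the extra degrees meet `h` on `S` and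
  -- exceed it at `w`, so their sum is at least one more than that of `h`.
  Admissible : (Fin n → ℕ) → Set
  Admissible h = ∀ S {w} → w ∈ S → Σˢ S d + c * count (_∈? S) < suc k' * Σˢ S h + (suc k' + c)

  Outcome : (Fin n → ℕ) → Set
  Outcome h = ∃ λ T → Tree T × (∀ v → extra T v ≤ h v)

  bounded-tree : Budget → ∀ h → Admissible h → Outcome h
  bounded-tree budget h admissible
    with small-degrees connected (λ v → degree F v + h v) no-barrier
    where
    no-barrier : ∀ {T} → Tree T → ¬ Barrier T (λ v → degree F v + h v)
    no-barrier {T} tree b = <-irrefl refl (begin-strict
      Σˢ S d + c * count (_∈? S)            <⟨ admissible S w∈S ⟩
      suc k' * Σˢ S h + (suc k' + c)        ≡⟨ trans (sym (+-assoc (suc k' * Σˢ S h) (suc k') c))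
          (cong (_+ c) (trans (+-comm (suc k' * Σˢ S h) (suc k')) (sym (*-suc (suc k') (Σˢ S h))))) ⟩
      suc k' * suc (Σˢ S h) + c             ≤⟨ +-monoˡ-≤ c (*-monoʳ-≤ (suc k') (Σˢ-mono-< S h≤extra w∈S h<extra)) ⟩
      suc k' * Σˢ S (extra T) + c           ≤⟨ budget tree S w∈S closed ⟩
      Σˢ S d + c * count (_∈? S)            ∎)
      where
      open Barrier b
      open ≤-Reasoning hiding (strict)
      split : ∀ v → degree T v ≡ degree F v + extra T v
      split = degree-split (Tree.F⊆T tree)
      h≤extra : ∀ {v} → v ∈ S → h v ≤ extra T v
      h≤extra {v} v∈ = +-cancelˡ-≤ (degree F v) _ _ (≤-trans (above v∈) (≤-reflexive (split v)))
      h<extra : h w < extra T w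
      h<extra = +-cancelˡ-< (degree F w) _ _ (≤-trans strict (≤-reflexive (split w)))
  ... | T , tree , le = T , tree , λ v → +-cancelˡ-≤ (degree F v) _ _
    (≤-trans (≤-reflexive (sym (degree-split (Tree.F⊆T tree) v))) (le v))

  -- This is `⌈(d + c)/k⌉` with `k = suc k'`; for `c = j * k'` it equals `⌈(d − j)/k⌉ + j`, the
  -- bound of the theorem with `d_F` taken off.
  cap : Fin n → ℕ
  cap v = (d v + c + k') / suc k'

  cap-except : Fin n → Fin n → ℕ
  cap-except u v = if does (v ≟ u) then d v / suc k' else cap v

  cap-except≤cap : ∀ u v → cap-except u v ≤ cap v
  cap-except≤cap u v with v ≟ u
  ... | no _  = ≤-refl
  ... | yes _ = /-monoˡ-≤ (suc k') (≤-trans (m≤m+n (d v) c) (m≤m+n (d v + c) k'))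

  cap-except-at : ∀ u → cap-except u u ≡ d u / suc k'
  cap-except-at u with u ≟ u
  ... | yes _ = refl
  ... | no ≢u = contradiction refl ≢u

  admissible-except : ∀ u → Admissible (cap-except u)
  admissible-except u S {w} w∈S = final iu iu≤1 summed
    where
    open ≤-Reasoning
    X Y iu : ℕ
    X = Σˢ S d + c * count (_∈? S)
    Y = suc k' * Σˢ S (cap-except u)
    iu = Σˢ S (λ v → ind (v ≟ u))

    -- Rounding down at `u` costs less than `k + c`. The indicator added on the left keeps this
    -- strictness through the summation.
    pointwise : ∀ v → d v + c + ind (v ≟ u) ≤ suc k' * cap-except u v + (suc k' + c) * ind (v ≟ u)
    pointwise v with v ≟ u
    ... | no _  = +-mono-≤ (ceiling-bound (d v + c) k') z≤n
    ... | yes _ = begin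
      d v + c + 1                              ≡⟨ +-comm (d v + c) 1 ⟩
      suc (d v) + c                            ≤⟨ +-monoˡ-≤ c (floor-bound (d v) k') ⟩
      suc k' * (d v / suc k') + suc k' + c     ≡⟨ trans (+-assoc (suc k' * (d v / suc k')) (suc k') c)
                                                    (cong (suc k' * (d v / suc k') +_) (sym (*-identityʳ (suc k' + c)))) ⟩
      suc k' * (d v / suc k') + (suc k' + c) * 1 ∎

    summed : X + iu ≤ Y + (suc k' + c) * iu
    summed = begin
      X + iu
        ≡⟨ cong (λ x → Σˢ S d + x + iu) (Σˢ-const S c) ⟨
      Σˢ S d + Σˢ S (λ _ → c) + iu
        ≡⟨ cong (_+ iu) (Σˢ-+ S d (λ _ → c)) ⟨
      Σˢ S (λ v → d v + c) + iu
        ≡⟨ Σˢ-+ S (λ v → d v + c) (λ v → ind (v ≟ u)) ⟨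
      Σˢ S (λ v → d v + c + ind (v ≟ u))
        ≤⟨ Σˢ-mono S (λ {v} _ → pointwise v) ⟩
      Σˢ S (λ v → suc k' * cap-except u v + (suc k' + c) * ind (v ≟ u))
        ≡⟨ Σˢ-+ S (λ v → suc k' * cap-except u v) (λ v → (suc k' + c) * ind (v ≟ u)) ⟩
      Σˢ S (λ v → suc k' * cap-except u v) + Σˢ S (λ v → (suc k' + c) * ind (v ≟ u))
        ≡⟨ cong₂ _+_ (Σˢ-* S (suc k') (cap-except u)) (Σˢ-* S (suc k' + c) (λ v → ind (v ≟ u))) ⟩
      Y + (suc k' + c) * iu ∎

    iu≤1 : iu ≤ 1
    iu≤1 = begin
      iu                          ≤⟨ ∑-mono (λ v → *-monoˡ-≤ (ind (v ≟ u)) (ind-≤1 (v ∈? S))) ⟩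
      ∑ (λ v → 1 * ind (v ≟ u))   ≡⟨ sum-cong-≗ {n} (λ v → *-identityˡ (ind (v ≟ u))) ⟩
      count (_≟ u)                ≡⟨ count-≡ u ⟩
      1                           ∎

    -- If `u` is outside `S`, the whole slack `k + c` is left and is positive; if `u` is in `S`, the
    -- slack is spent and the spare unit on the left gives strictness.
    final : ∀ i → i ≤ 1 → X + i ≤ Y + (suc k' + c) * i → X < Y + (suc k' + c)
    final zero _ le = begin-strict
      X                          ≡⟨ +-identityʳ X ⟨
      X + 0                      ≤⟨ le ⟩
      Y + (suc k' + c) * 0       ≡⟨ cong (Y +_) (*-zeroʳ (suc k' + c)) ⟩
      Y + 0                      <⟨ +-monoʳ-< Y (s≤s z≤n) ⟩
      Y + (suc k' + c)           ∎
    final (suc zero) _ le = begin-strict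
      X                          <⟨ n<1+n X ⟩
      suc X                      ≡⟨ +-comm 1 X ⟩
      X + 1                      ≤⟨ le ⟩
      Y + (suc k' + c) * 1       ≡⟨ cong (Y +_) (*-identityʳ (suc k' + c)) ⟩
      Y + (suc k' + c)           ∎
    final (suc (suc _)) (s≤s ())

  -- Follows from the bound reduced at `w`, since raising `h` preserves admissibility.
  admissible : Admissible cap
  admissible S {w} w∈S = ≤-trans (admissible-except w S w∈S)
    (+-monoˡ-≤ (suc k' + c) (*-monoʳ-≤ (suc k') (Σˢ-mono S λ {v} _ → cap-except≤cap w v)))

-- Translation to the definitions of the statement

deg≡degree : ∀ {n} (G : Graph n) (U : EdgeSet G) v → deg G U v ≡ Joining.degree G U v
deg≡degree G U v = trans (cong sum (map-tabulate id indicator)) (trans (∑-tabulate indicator)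
  (sum-cong-≗ {m G} λ i → cong (λ b → if b ∧ incidentᵇ G i v then 1 else 0) (lookup≡does i)))
  where
  indicator : Fin (m G) → ℕ
  indicator i = if lookup U i ∧ incidentᵇ G i v then 1 else 0
  lookup≡does : ∀ i → lookup U i ≡ does (i ∈? U)
  lookup≡does i with i ∈? U
  ... | yes i∈ = []=⇒lookup i∈
  ... | no i∉ with lookup U i in eq
  ...   | true  = contradiction (lookup⇒[]= i U eq) i∉
  ...   | false = refl

─⇒≢ : ∀ {l} (U : Subset l) {i j} → j ∈ U ─ i → j ∈ U × j ≢ i
─⇒≢ U {i} {j} j∈ with j ≟ i
... | yes refl with () ← trans (sym ([]=⇒lookup j∈)) (lookup∘updateAt i U)
... | no j≢i = lookup⇒[]= j U (trans (sym (lookup∘updateAt′ j i j≢i U)) ([]=⇒lookup j∈)) , j≢i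

≢⇒─ : ∀ {l} (U : Subset l) {i j} → j ∈ U → j ≢ i → j ∈ U ─ i
≢⇒─ U {i} {j} j∈ j≢i = lookup⇒[]= j (U ─ i) (trans (lookup∘updateAt′ j i j≢i U) ([]=⇒lookup j∈))

module Conclusion {n : ℕ} (G : Graph n) (F : EdgeSet G) (acyclic : SpanningForest G F) where

  open Joining G
  open Touching G F

  forest : ∀ {i} → i ∈ F → ¬ Closes (λ j → j ∈ F × j ≢ i) i
  forest i∈ c = acyclic _ i∈ (joined⇒reach (joined-⊆ (λ (j∈ , j≢) → ≢⇒─ F j∈ j≢) c))

  open Descent G F forest

  spanning-tree : ∀ {T} → Tree T → SpanningTree G T
  spanning-tree {T} tree = (λ u v → joined⇒reach (Tree.connected tree u v)) ,
    λ i i∈ r → Tree.bridge tree i∈ (joined-⊆ (─⇒≢ T) (reach⇒joined r))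

  deg-split : ∀ {U} → F ⊆ U → ∀ v → deg G U v ≡ deg G F v + extra U v
  deg-split {U} F⊆U v = trans (deg≡degree G U v)
    (trans (degree-split F⊆U v) (cong (_+ extra U v) (sym (deg≡degree G F v))))

  CeilingBound : ℕ → ℕ → EdgeSet G → Fin n → Set
  CeilingBound k' j T v = ℤ.+ deg G T v ℤ.≤
    ⌈ ℤ.+ degG G v ℤ.- ℤ.+ deg G F v ℤ.- ℤ.+ j / suc k' ⌉ ℤ.+ ℤ.+ deg G F v ℤ.+ ℤ.+ j

  TreeEverywhere : ℕ → ℕ → Set
  TreeEverywhere k' j = ∃ λ T → SpanningTree G T × F ⊆ T × (∀ v → CeilingBound k' j T v)

  TreeReducedAt : ℕ → ℕ → Fin n → Set
  TreeReducedAt k' j u = ∃ λ T → SpanningTree G T × F ⊆ T ×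
    (∀ v → v ≢ u → CeilingBound k' j T v) × ReducedBound (suc k') G F T u

  Conclusions : ℕ → ℕ → Set
  Conclusions k' j = TreeEverywhere k' j × (∀ u → TreeReducedAt k' j u)

  module _ (connected : ∀ u v → Joined (λ _ → ⊤) u v) (k' j : ℕ) where

    open Assembly G F forest connected k' (j * k')

    ceiling : ∀ {T} → Tree T → ∀ v → extra T v ≤ cap v → CeilingBound k' j T v
    ceiling tree v le rewrite deg-split (Tree.F⊆T tree) v | deg-split {full} (λ _ → ∈⊤) v =
      ceiling-ℤ j (d v) k' _ (deg G F v) le

    reduced : ∀ {T} → Tree T → ∀ u → extra T u ≤ d u / suc k' → ReducedBound (suc k') G F T u
    reduced tree u le rewrite deg-split (Tree.F⊆T tree) u | deg-split {full} (λ _ → ∈⊤) u =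
      floor-ℤ (d u) k' _ (deg G F u) le

    conclude : Budget → Conclusions k' j
    conclude budget = everywhere (bounded-tree budget cap admissible) ,
      λ u → except u (bounded-tree budget (cap-except u) (admissible-except u))
      where
      everywhere : Outcome cap → TreeEverywhere k' j
      everywhere (T , tree , le) = T , spanning-tree tree , (λ i∈ → Tree.F⊆T tree i∈) , λ v → ceiling tree v (le v)
      except : ∀ u → Outcome (cap-except u) → TreeReducedAt k' j u
      except u (T , tree , le) = T , spanning-tree tree , (λ i∈ → Tree.F⊆T tree i∈) ,
        (λ v _ → ceiling tree v (≤-trans (le v) (cap-except≤cap u v))) ,
        reduced tree u (≤-trans (le u) (≤-reflexive (cap-except-at u)))

  module _ {c : ℕ} (H : Graph c) (φ : Fin n → Fin c) (con : IsContraction G F φ H) where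

    open Contraction G F H φ con using (module H; connected-above)

    edge-case : ∀ k' → EdgeConnected (suc k') H → Conclusions k' 2
    edge-case k' ec = conclude connected k' 2 (budget k' ec)
      where
      connected : ∀ u v → Joined (λ _ → ⊤) u v
      connected = connected-above λ x y → H.joined-⊆ _
        -- Deleting no edge at all is allowed because `0 < k`.
        (reach⇒joined (ec empty (subst (_< suc k') (sym (∣⊥∣≡0 (m H))) (s≤s z≤n)) x y))
      budget : ∀ k' → EdgeConnected (suc k') H → Assembly.Budget G F forest connected k' (2 * k')
      -- For `k = 1` the constant `c` vanishes and the tree having no more edges than `G` is enough;
      -- `edge-arithmetic` covers `k ≥ 2`.
      budget zero ec tree S w∈S closed =
        +-monoˡ-≤ 0 (≤-trans (≤-reflexive (*-identityˡ _)) extra-mono)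
        where open ClosedSet G F _ (Tree.F⊆T tree) (Tree.bridge tree) (Tree.connected tree) S _ w∈S closed
      budget (suc k) ec tree S w∈S closed =
        let q , p₁ , p₂ = EdgeCut.components H φ con (suc (suc k)) ec in
        subst₂ (λ x y → suc (suc k) * x + 2 * suc k ≤ y + 2 * suc k * count (_∈? S))
          (sym extra-T) (sym extra-full)
          (edge-arithmetic k {count B?} {inner _} {q} p₁ p₂ boundary-bound inner-mono inner-forest)
        where open ClosedSet G F _ (Tree.F⊆T tree) (Tree.bridge tree) (Tree.connected tree) S _ w∈S closed

    tree-case : ∀ k' → TreeConnected (suc k') H → Conclusions k' 1
    tree-case k' (Ts , trees , disjoint) = conclude connected k' 1 budget
      where
      spanning : ∀ j x y → H.Joined (_∈ Ts j) x y
      spanning j x y = reach⇒joined (proj₁ (trees j) x y)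
      connected : ∀ u v → Joined (λ _ → ⊤) u v
      connected = connected-above λ x y → H.joined-⊆ _ (spanning zero x y)
      budget : Assembly.Budget G F forest connected k' (1 * k')
      budget tree S w∈S closed =
        subst₂ (λ x y → suc k' * x + 1 * k' ≤ y + 1 * k' * count (_∈? S))
          (sym extra-T) (sym extra-full)
          (tree-arithmetic k' {count B?} {inner _} (TreePacking.B-packing H φ con (suc k') Ts spanning disjoint)
            inner-mono inner-forest)
        where open ClosedSet G F _ (Tree.F⊆T tree) (Tree.bridge tree) (Tree.connected tree) S _ w∈S closed

theorem3p4 : (k : ℕ) .{{_ : NonZero k}} {n : ℕ} (G : Graph n) (F : EdgeSet G) →
    SpanningForest G F →
    (ContractionHas G F (EdgeConnected k) →
    (Σ (EdgeSet G) λ T → SpanningTree G T × F ⊆ T ×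
    (∀ v → EdgeConnBound k G F T v)) ×
    (∀ (u : Fin n) → Σ (EdgeSet G) λ T → SpanningTree G T × F ⊆ T ×
    (∀ v → v ≢ u → EdgeConnBound k G F T v) × ReducedBound k G F T u)) ×
    (ContractionHas G F (TreeConnected k) →
    (Σ (EdgeSet G) λ T → SpanningTree G T × F ⊆ T ×
    (∀ v → TreeConnBound k G F T v)) ×
    (∀ (u : Fin n) → Σ (EdgeSet G) λ T → SpanningTree G T × F ⊆ T ×
    (∀ v → v ≢ u → TreeConnBound k G F T v) × ReducedBound k G F T u))
theorem3p4 zero = contradiction refl (≢-nonZero⁻¹ 0)
theorem3p4 (suc k') G F acyclic =
  (λ (c , φ , H , con , connected) → Conclusion.edge-case G F acyclic H φ con k' connected) ,
  (λ (c , φ , H , con , packing) → Conclusion.tree-case G F acyclic H φ con k' packing)
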